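{- Let $\Gamma_1,\Gamma_2$ be non-empty sets of cycles such that the shortest cycle in $\Gamma_1$ has length $n\geq 6$ and the shortest cycle in $\Gamma_2$ has length $4$. Then a red-blue graph $G$ is $(\Gamma_1,\Gamma_2)$-critical if and only if its blue subgraph $G_{\mathrm{blue}}$ belongs (up to isomorphism) to $\mathcal G_1\cup\mathcal G_2\cup\mathcal G_3$, where $\mathcal G_1,\mathcal G_2,\mathcal G_3$ are the sets of graphs on $n$ vertices defined in the context.
   Context: All graphs are finite, simple and undirected. A red-blue graph is a complete graph with each edge coloured red or blue; its blue subgraph $G_{\mathrm{blue}}$ is the uncoloured graph with vertex set $V(G)$ whose edges are the blue edges. $R(\Gamma_1,\Gamma_2)$ is the least positive integer $N$ such that each red-blue graph on $N$ vertices contains a red subgraph from $\Gamma_1$ or a blue subgraph from $\Gamma_2$. A red-blue graph is $(\Gamma_1,\Gamma_2)$-avoiding if it contains neither a red subgraph from $\Gamma_1$ nor a blue subgraph from $\Gamma_2$; it is $(\Gamma_1,\Gamma_2)$-critical if moreover it has $R(\Gamma_1,\Gamma_2)-1$ vertices. $N(u)$ and $d(u)$ denote the set and the number of neighbours of a vertex $u$. A graph $H$ has a matching on $U\subseteq V(H)$ if each vertex in $U$ has degree at most $1$ in the induced subgraph $H[U]$. For $n\geq 6$, the sets $\mathcal G_i$ consist of graphs on the $n$-element vertex set $\{v\}\cup X\cup\{y\}$ with $X=\{x_1,\ldots,x_{n-2}\}$, as follows: - $\mathcal G_1$: the graphs with $N(v)=X$, having a matching on $X\cup\{y\}$; - $\mathcal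 G_2$: the graphs with $N(v)=X$, $N(y)=\{x_{n-2}\}$ and $d(x_{n-2})=3$, having a matching on $X$; - $\mathcal G_3$: the graphs with $N(v)=X\cup\{y\}$, having a matching on $X\cup\{y\}$. -}

module Defs where

open import Data.Fin.Base using (Fin; toℕ; fromℕ<)
open import Data.Fin.Properties as Fin using ()
open import Data.Fin.Subset using (Subset; ⁅_⁆; ∁; _∪_; _∩_; ∣_∣; _∈_)
open import Data.Nat.Base using (ℕ; suc; _∸_; _≤_; _<_; z≤n; s≤s)
open import Data.Nat.Properties as ℕ using ()
open import Data.Product.Base using (∃; _×_; _,_)
open import Data.Sum.Base using (_⊎_; inj₁; inj₂; swap)
open import Data.Vec.Base using (tabulate)
open import Function.Base using (_∘_)
open import Function.Bundles using (_↔_; _⇔_; module Inverse)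
open import Function.Definitions using (Injective)
open import Level using (0ℓ)
open import Relation.Binary.Core using (Rel)
open import Relation.Binary.Definitions using (Decidable; DecidableEquality; Symmetric)
open import Relation.Binary.PropositionalEquality
  using (_≡_; _≢_; refl; sym; trans; ≢-sym)
open import Relation.Nullary using (¬_; yes; no; does; ¬?; _×-dec_; _⊎-dec_)
open import Relation.Unary as Unary using (Pred)

record Graph (N : ℕ) : Set₁ where
  field
    Adj        : Rel (Fin N) 0ℓ
    adj?       : Decidable Adj
    adj-sym    : Symmetric Adj
    adj-irrefl : ∀ u → ¬ Adj u u

  neighbours : Fin N → Subset N
  neighbours u = tabulate (does ∘ adj? u)

  degree : Fin N → ℕ
  degree u = ∣ neighbours u ∣

open Graph public

-- H ⊑ G: G has a (not necessarily induced) subgraph isomorphic to H.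
record _⊑_ {M N : ℕ} (H : Graph M) (G : Graph N) : Set where
  field
    embed     : Fin M → Fin N
    injective : Injective _≡_ _≡_ embed
    preserves : ∀ {u v} → Adj H u v → Adj G (embed u) (embed v)

record _≅_ {M N : ℕ} (G : Graph M) (H : Graph N) : Set where
  field
    bijection : Fin M ↔ Fin N
    adj⇔      : ∀ u v → Adj G u v ⇔ Adj H (Inverse.to bijection u) (Inverse.to bijection v)

-- For u ∈ U, ∣ neighbours H u ∩ U ∣ is the degree of u in the induced
-- subgraph H[U].
HasMatchingOn : ∀ {N} → Graph N → Subset N → Set
HasMatchingOn H U = ∀ {u} → u ∈ U → ∣ neighbours H u ∩ U ∣ ≤ 1

-- A cycle, taken up to isomorphism, is determined by its length.
record Cycle : Set where
  constructor cycle
  field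
    length   : ℕ
    3≤length : 3 ≤ length

open Cycle public

CyclicSuc : ∀ {k} → Rel (Fin k) 0ℓ
CyclicSuc {k} i j = (toℕ j ≡ suc (toℕ i)) ⊎ (suc (toℕ i) ≡ k × toℕ j ≡ 0)

cyclicSuc? : ∀ {k} → Decidable (CyclicSuc {k})
cyclicSuc? {k} i j =
  (toℕ j ℕ.≟ suc (toℕ i)) ⊎-dec ((suc (toℕ i) ℕ.≟ k) ×-dec (toℕ j ℕ.≟ 0))

cyclicSuc-irrefl : ∀ {k} → 3 ≤ k → (i : Fin k) → ¬ CyclicSuc i i
cyclicSuc-irrefl _ i (inj₁ e) = ℕ.1+n≢n (sym e)
cyclicSuc-irrefl 3≤k i (inj₂ (e , i≡0)) rewrite i≡0 | sym e with 3≤k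
... | s≤s ()

cycleGraph : (C : Cycle) → Graph (length C)
cycleGraph C = record
  { Adj        = λ i j → CyclicSuc i j ⊎ CyclicSuc j i
  ; adj?       = λ i j → cyclicSuc? i j ⊎-dec cyclicSuc? j i
  ; adj-sym    = swap
  ; adj-irrefl = λ { i (inj₁ p) → cyclicSuc-irrefl (3≤length C) i p
                   ; i (inj₂ p) → cyclicSuc-irrefl (3≤length C) i p }
  }

CycleSet : Set₁
CycleSet = Pred Cycle 0ℓ

IsShortestLength : CycleSet → ℕ → Set
IsShortestLength Γ n =
  (∃ λ C → Γ C × length C ≡ n) × (∀ C → Γ C → n ≤ length C)

data Colour : Set where
  red blue : Colour

_≟ᶜ_ : DecidableEquality Colour
red  ≟ᶜ red  = yes refl
red  ≟ᶜ blue = no λ ()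
blue ≟ᶜ red  = no λ ()
blue ≟ᶜ blue = yes refl

-- The values colour u u on the diagonal carry no meaning; they are discarded
-- by colourClass below.
record RedBlueGraph (N : ℕ) : Set where
  field
    colour     : Fin N → Fin N → Colour
    colour-sym : ∀ u v → colour u v ≡ colour v u

open RedBlueGraph public

colourClass : ∀ {N} → Colour → RedBlueGraph N → Graph N
colourClass c G = record
  { Adj        = λ u v → u ≢ v × colour G u v ≡ c
  ; adj?       = λ u v → ¬? (u Fin.≟ v) ×-dec (colour G u v ≟ᶜ c)
  ; adj-sym    = λ {u} {v} (u≢v , e) → ≢-sym u≢v , trans (colour-sym G v u) e
  ; adj-irrefl = λ u (u≢u , _) → u≢u refl
  }

redSubgraph blueSubgraph : ∀ {N} → RedBlueGraph N → Graph N
redSubgraph  = colourClass red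
blueSubgraph = colourClass blue

ContainsFrom : ∀ {N} → CycleSet → Graph N → Set
ContainsFrom Γ G = ∃ λ C → Γ C × cycleGraph C ⊑ G

module _ (Γ₁ Γ₂ : CycleSet) where

  Avoiding : ∀ {N} → RedBlueGraph N → Set
  Avoiding G = ¬ ContainsFrom Γ₁ (redSubgraph G) × ¬ ContainsFrom Γ₂ (blueSubgraph G)

  Arrows : ℕ → Set
  Arrows N = (G : RedBlueGraph N) →
    ContainsFrom Γ₁ (redSubgraph G) ⊎ ContainsFrom Γ₂ (blueSubgraph G)

  -- R is the Ramsey number R(Γ₁,Γ₂), given as a relation since its existence
  -- is not a matter of definition.
  IsRamseyNumber : ℕ → Set
  IsRamseyNumber R = 0 < R × Arrows R × (∀ M → 0 < M → Arrows M → R ≤ M)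

  Critical : ∀ {N} → RedBlueGraph N → Set
  Critical {N} G = Avoiding G × ∃ λ R → IsRamseyNumber R × N ≡ R ∸ 1

-- The vertex set {v} ∪ {x₁,…,xₙ₋₂} ∪ {y} is Fin n, in the order
-- v, x₁, …, xₙ₋₂, y; thus xᵢ is the vertex with toℕ equal to i.
module Families (n : ℕ) (6≤n : 6 ≤ n) where

  private
    0<n : 0 < n
    0<n = ℕ.≤-trans (s≤s z≤n) 6≤n

    2≤n : 2 ≤ n
    2≤n = ℕ.≤-trans (s≤s (s≤s z≤n)) 6≤n

  v y xₙ₋₂ : Fin n
  v    = fromℕ< {0} 0<n
  xₙ₋₂ = fromℕ< {n ∸ 2} (ℕ.∸-monoʳ-< (s≤s z≤n) 2≤n)
  y    = fromℕ< {n ∸ 1} (ℕ.∸-monoʳ-< (s≤s z≤n) 0<n)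

  X : Subset n
  X = ∁ (⁅ v ⁆ ∪ ⁅ y ⁆)

  𝒢₁ 𝒢₂ 𝒢₃ : Pred (Graph n) 0ℓ
  𝒢₁ H = neighbours H v ≡ X × HasMatchingOn H (X ∪ ⁅ y ⁆)
  𝒢₂ H = neighbours H v ≡ X
       × neighbours H y ≡ ⁅ xₙ₋₂ ⁆
       × degree H xₙ₋₂ ≡ 3
       × HasMatchingOn H X
  𝒢₃ H = neighbours H v ≡ X ∪ ⁅ y ⁆ × HasMatchingOn H (X ∪ ⁅ y ⁆)

  𝒢 : Pred (Graph n) 0ℓ
  𝒢 = 𝒢₁ Unary.∪ 𝒢₂ Unary.∪ 𝒢₃

open Families public using (𝒢)

_∈-upToIso_ : ∀ {M n} → Graph M → Pred (Graph n) 0ℓ → Set₁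
G ∈-upToIso 𝒫 = ∃ λ H → 𝒫 H × G ≅ H

{-# OPTIONS --safe #-}
module Submission where

-- The heart of the proof is that on n ≥ 6 vertices, if the blue graph has no C₄
-- and every red degree is at least 2, then there is a red Hamiltonian cycle.
-- For n = 6 this is a finite search.  For larger n, some vertex w has a red
-- cycle through all the other vertices: otherwise, deleting any vertex leaves a
-- vertex that is blue to all but at most one of the rest; doing this twice gives
-- two distinct such vertices, and they share two blue neighbours.  Let a and b be
-- two red neighbours of w on that cycle.  If no rerouting inserts w between a
-- and b, then w is blue to the cycle neighbours of a and b, the two successors of
-- a and b are joined in blue, and so are the two predecessors; one of these blue
-- edges then closes a blue C₄ through w.
-- Hence a critical graph has a vertex v that is blue to all vertices but at most
-- one, y, and C₄-freeness at v leaves only the three families.  The same deletion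
-- argument shows that the Ramsey number is at most n + 1, and a blue star on at
-- most n vertices shows that it is at least n + 1.

open import Data.Bool.Base using (Bool; true; false; if_then_else_; _∧_; _∨_; T)
open import Data.Bool.ListAction using (any)
open import Data.Bool.Properties using (T-∧; T-∨)
open import Data.Empty using (⊥-elim)
open import Data.Fin.Base using (Fin; zero; suc; toℕ; fromℕ<; inject₁; punchOut)
open import Data.Fin.Permutation as Permutation
  using (Permutation′; flip; _⟨$⟩ʳ_; _∘ₚ_; transpose; inverseʳ; ↔⇒≡)
open import Data.Fin.Properties as Fin
  using (toℕ-fromℕ<; toℕ<n; toℕ-inject₁; fromℕ<-injective; injective⇒≤; punchOut-injective)
open import Data.Fin.Subset
  using (Subset; inside; outside; ⁅_⁆; _∪_; ∣_∣; _∈_; _⊆_; _-_)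
open import Data.Fin.Subset.Properties
  using (x∈p∧x≢y⇒x∈p-y; x∈p⇒∣p-x∣<∣p∣; nonempty?; Empty-unique; ∣⊥∣≡0; ∣⁅x⁆∣≡1; p⊆q⇒∣p∣≤∣q∣;
    x∈⁅x⁆; x∈⁅y⁆⇒x≡y; ∪-identityʳ; x∈p∪q⁺; x∈p∪q⁻; x∈p∩q⁺; x∈p∩q⁻; ⊆-antisym; x∉p⇒x∈∁p; x∈∁p⇒x∉p)
open import Data.List.Base as List
  using (List; []; _∷_; _++_; [_]; map; concatMap; cartesianProductWith; filter; null; reverse; lookup; allFin)
open import Data.List.Membership.Propositional using (find; lose) renaming (_∈_ to _∈ˡ_)
open import Data.List.Membership.Propositional.Properties
  using (∈-++⁺ˡ; ∈-++⁺ʳ; ∈-∃++; ∈-lookup; ∈-allFin; ∈-map⁺; ∈-filter⁺)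
open import Data.List.Properties using (unfold-reverse; length-tabulate; map-∘)
open import Data.List.Relation.Binary.Permutation.Propositional
  using (_↭_; ↭-refl; ↭-sym; ↭-trans; ↭-prep; ↭-swap; ↭⇒↭ₛ)
open import Data.List.Relation.Binary.Permutation.Propositional.Properties as ↭
  using (++-commutativeMonoid; ↭-reverse; ↭-length; ++⁺ˡ; ++⁺ʳ; ++-comm; ∈-resp-↭; shift)
import Data.List.Relation.Binary.Permutation.Setoid.Properties as ↭ₛ
open import Data.List.Relation.Unary.All as All using (All; []; _∷_)
import Data.List.Relation.Unary.All.Properties as All
open import Data.List.Relation.Unary.AllPairs using ([]; _∷_)
open import Data.List.Relation.Unary.Any as Any using (Any; here; there)
import Data.List.Relation.Unary.Any.Properties as Any
open import Data.List.Relation.Unary.Unique.DecPropositional using (unique?)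
open import Data.List.Relation.Unary.Unique.Propositional using (Unique)
import Data.List.Relation.Unary.Unique.Propositional.Properties as Unique
open import Data.Nat.Base using (ℕ; zero; suc; _+_; _∸_; _≤_; _<_; z≤n; s≤s; z<s; s<s⁻¹)
open import Data.Nat.Properties as ℕ using ()
open import Data.Product.Base using (∃; ∃-syntax; _×_; _,_; proj₂)
open import Data.Sum.Base using (_⊎_; inj₁; inj₂; [_,_]′)
open import Data.Unit.Base using (tt)
open import Data.Vec.Base as Vec using ()
open import Data.Vec.Properties using (lookup∘tabulate; []=⇒lookup; lookup⇒[]=)
open import Function.Base using (_∘_; _on_; id)
open import Function.Bundles using (_⇔_; mk⇔; module Equivalence; module Injection; module Inverse)
open import Function.Definitions using (Injective)
open import Function.Properties.Inverse using (↔⇒↣)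
open import Level using (0ℓ)
open import Relation.Binary.Core using (Rel)
open import Relation.Binary.Definitions using (Decidable; DecidableEquality; Symmetric)
open import Relation.Binary.PropositionalEquality
  using (_≡_; _≢_; refl; sym; trans; cong; cong₂; subst; subst₂; ≢-sym; setoid)
open import Relation.Nullary using (¬_; Dec; yes; no; does; contradiction; map′; ¬?; _×-dec_)
open import Relation.Nullary.Decidable using (dec-true; dec-false; decidable-stable)
open import Relation.Unary using (Pred; Satisfiable)
import Algebra.Solver.CommutativeMonoid as CommutativeMonoidSolver
open import Defs

-- Lists without repetition and their permutations.

private
  variable
    A C : Set
    k n N : ℕ
    x x′ z w t : A
    xs ys : List A

∈-++-≢ : Unique (xs ++ ys) → x ∈ˡ xs → t ∈ˡ ys → x ≢ t
∈-++-≢ {xs = x ∷ xs} (x∉ ∷ _) (here refl) y∈ = All.lookup x∉ (∈-++⁺ʳ xs y∈)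
∈-++-≢ (_ ∷ u) (there x∈) y∈ = ∈-++-≢ u x∈ y∈

Unique-++⁻ʳ : ∀ (xs : List A) → Unique (xs ++ ys) → Unique ys
Unique-++⁻ʳ []       u       = u
Unique-++⁻ʳ (_ ∷ xs) (_ ∷ u) = Unique-++⁻ʳ xs u

Unique-resp-↭ : xs ↭ ys → Unique xs → Unique ys
Unique-resp-↭ xs↭ys = ↭ₛ.Unique-resp-↭ (setoid _) (↭⇒↭ₛ xs↭ys)

∈⇒↭∷ : x ∈ˡ xs → ∃[ ys ] xs ↭ x ∷ ys
∈⇒↭∷ {x = x} x∈xs with ys , zs , refl ← ∈-∃++ x∈xs = ys ++ zs , shift x ys zs

∈-tail : x ∈ˡ w ∷ xs → w ≢ x → x ∈ˡ xs
∈-tail (here x≡w) w≢x = contradiction (sym x≡w) w≢x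
∈-tail (there x∈) _   = x∈

-- Pigeonhole: as `xs` has no repetition, each entry of `ys` rules out at most one entry of `xs`.
-- This supplies vertices outside a short list of exceptions.
∃∉ : DecidableEquality A → ∀ (ys : List A) → Unique xs → List.length ys < List.length xs →
     ∃[ x ] x ∈ˡ xs × All (_≢ x) ys
∃∉ {xs = x ∷ xs} _≟_ [] _ _ = x , here refl , []
∃∉ {xs = xs} _≟_ (y ∷ ys) u lt with Any.any? (y ≟_) xs
... | no y∉xs with z , z∈ , z∉ys ← ∃∉ _≟_ ys u (ℕ.<-trans (ℕ.n<1+n _) lt) =
  z , z∈ , (λ y≡z → y∉xs (subst (_∈ˡ xs) (sym y≡z) z∈)) ∷ z∉ys
... | yes y∈xs with xs′ , σ ← ∈⇒↭∷ y∈xs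
    with y∉ ∷ u′ ← Unique-resp-↭ σ u
    with z , z∈ , z∉ys ← ∃∉ _≟_ ys u′ (s<s⁻¹ (subst (List.length (y ∷ ys) <_) (↭-length σ) lt)) =
  z , ∈-resp-↭ (↭-sym σ) (there z∈) , All.lookup y∉ z∈ ∷ z∉ys

-- Paths and cycles written as lists.

-- In Path R x p t, the list p includes both ends x and t.
data Path (R : Rel A 0ℓ) : A → List A → A → Set where
  stop : Path R x [ x ] x
  _∷_  : R x t → Path R t xs z → Path R x (x ∷ xs) z

module _ {R : Rel A 0ℓ} where

  infixr 5 _⟨_⟩_

  _⟨_⟩_ : Path R x xs t → R t z → Path R z ys w → Path R x (xs ++ ys) w
  stop    ⟨ e ⟩ q = e ∷ q
  (d ∷ p) ⟨ e ⟩ q = d ∷ (p ⟨ e ⟩ q)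

  first-∈ : Path R x xs t → x ∈ˡ xs
  first-∈ stop    = here refl
  first-∈ (_ ∷ _) = here refl

  last-∈ : Path R x xs t → t ∈ˡ xs
  last-∈ stop    = here refl
  last-∈ (_ ∷ p) = there (last-∈ p)

  Path-reverse : Symmetric R → Path R x xs t → Path R t (reverse xs) x
  Path-reverse R-sym stop = stop
  Path-reverse R-sym (_∷_ {x = x} {xs = xs} e p) =
    subst (λ l → Path R _ l x) (sym (unfold-reverse x xs)) (Path-reverse R-sym p ⟨ R-sym e ⟩ stop)

  -- The cut falls just before `z` and both pieces are non-empty, which is why `cutAt` treats `z`
  -- equal to the start apart.
  data CutAt (x z t : A) : List A → Set where
    cut : ∀ {u} → Path R x xs u → R u z → Path R z ys t → CutAt x z t (xs ++ ys)

  cutAt : Path R x xs t → z ∈ˡ xs → z ≡ x ⊎ CutAt x z t xs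
  cutAt stop    (here z≡x) = inj₁ z≡x
  cutAt (_ ∷ _) (here z≡x) = inj₁ z≡x
  cutAt (e ∷ p) (there z∈p) with cutAt p z∈p
  ... | inj₁ refl           = inj₂ (cut stop e p)
  ... | inj₂ (cut p₁ d p₂) = inj₂ (cut (e ∷ p₁) d p₂)

-- Only the vertices of the cycle are recorded, up to order. Distinctness and length at least 3 are
-- supplied separately, by `Unique` and by the length of a `Cycle`.
HasCycleOn : Rel A 0ℓ → List A → Set
HasCycleOn R L = ∃[ x ] ∃[ t ] ∃[ p ] Path R x p t × R t x × p ↭ L

HasCycleOn-resp-↭ : ∀ {R : Rel A 0ℓ} → xs ↭ ys → HasCycleOn R xs → HasCycleOn R ys
HasCycleOn-resp-↭ xs↭ys (x , t , p , path , e , p↭xs) = x , t , p , path , e , ↭-trans p↭xs xs↭ys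

-- Rotation: cut before `x` and join the two pieces in the other order along the old closing edge.
cycleFrom : ∀ {R : Rel A 0ℓ} → HasCycleOn R xs → x ∈ˡ xs →
            ∃[ t ] ∃[ p ] Path R x p t × R t x × p ↭ xs
cycleFrom (u , t , p , path , e , p↭xs) x∈xs with cutAt path (∈-resp-↭ (↭-sym p↭xs) x∈xs)
... | inj₁ refl = t , p , path , e , p↭xs
... | inj₂ (cut {xs = q₁} {ys = q₂} p₁ d p₂) =
  _ , q₂ ++ q₁ , (p₂ ⟨ e ⟩ p₁) , d , ↭-trans (++-comm q₂ q₁) p↭xs

-- Two-colourings without a blue C₄.

-- Only opposite corners are asked to differ; adjacent corners differ anyway in an adjacency
-- relation.
C4Free : Rel A 0ℓ → Set
C4Free B = ∀ {s t u v} → s ≢ u → t ≢ v → B s t → B t u → B u v → ¬ B v s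

TwoNeighboursIn : Rel A 0ℓ → List A → A → Set
TwoNeighboursIn R L w = ∃[ a ] ∃[ b ] a ∈ˡ L × b ∈ˡ L × a ≢ b × R w a × R w b

lookup-injective : Unique xs → ∀ {i j} → lookup xs i ≡ lookup xs j → i ≡ j
lookup-injective (x∉ ∷ u) {zero}  {zero}  eq = refl
lookup-injective (x∉ ∷ u) {zero}  {suc j} eq = contradiction eq (All.lookup x∉ (∈-lookup j))
lookup-injective (x∉ ∷ u) {suc i} {zero}  eq = contradiction (sym eq) (All.lookup x∉ (∈-lookup i))
lookup-injective (x∉ ∷ u) {suc i} {suc j} eq = cong suc (lookup-injective u eq)

-- The vertices form an arbitrary type, so that a colouring can be pulled back along a list of six
-- vertices to `Fin 6`, where the search takes place.
record TwoColouring (A : Set) : Set₁ where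
  field
    R B      : Rel A 0ℓ
    R-sym    : Symmetric R
    B-sym    : Symmetric B
    R-irrefl : ∀ x → ¬ R x x
    R?       : Decidable R
    R⊎B      : ∀ {x t} → x ≢ t → R x t ⊎ B x t

  ¬R⇒B : x ≢ t → ¬ R x t → B x t
  ¬R⇒B x≢t ¬r with R⊎B x≢t
  ... | inj₁ r = contradiction r ¬r
  ... | inj₂ b = b

  R⇒≢ : R x t → x ≢ t
  R⇒≢ e refl = R-irrefl _ e

pullback : ∀ {C : Set} (f : C → A) → (∀ {i j} → f i ≡ f j → i ≡ j) → TwoColouring A → TwoColouring C
pullback f f-inj K = record
  { R        = R on f
  ; B        = B on f
  ; R-sym    = R-sym
  ; B-sym    = B-sym
  ; R-irrefl = λ x → R-irrefl (f x)
  ; R?       = λ x t → R? (f x) (f t)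
  ; R⊎B      = λ x≢t → R⊎B (x≢t ∘ f-inj)
  }
  where open TwoColouring K

-- Inserting a vertex into a red cycle.

module _ {A : Set} (K : TwoColouring A) (c4free : C4Free (TwoColouring.B K)) where

  open TwoColouring K

  private
    variable
      a b u : A
      P Q : List A

  open CommutativeMonoidSolver (++-commutativeMonoid {A = A}) using (Expr; solve; _⊕_; _⊜_)

  private
    arcs : ∀ {n} (w a P b Q : Expr n) → Expr n
    arcs w a P b Q = w ⊕ ((a ⊕ P) ⊕ (b ⊕ Q))

  -- The cycle is a, x, P, b, Q, where P leads from x′ to u and Q from z to t.
  -- Cutting out Q makes room for w between a and b; C₄-freeness allows the
  -- reversal of Q to be put back between x and x′.
  reverseIntoArc : Unique (w ∷ (a ∷ x ∷ P) ++ b ∷ Q) → z ≢ t →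
    R w a → R w b → R a x → Path R x′ P u → R u b → Path R z Q t →
    B w x → B w z → B w t → B w x′ → B x z →
    HasCycleOn R (w ∷ (a ∷ x ∷ P) ++ b ∷ Q)
  reverseIntoArc {w = w} {a = a} {x = x} {P = P} {b = b} {Q = Q}
    ((_ ∷ w≢x ∷ w∉) ∷ _ ∷ x∉ ∷ PbQ-unique) z≢t wa wb ax p ub q wx wz wt wx′ xz
    with R⊎B (All.lookup x∉ (∈-++⁺ʳ P (there (last-∈ q))))
       | R⊎B (∈-++-≢ PbQ-unique (first-∈ p) (there (first-∈ q)))
  -- A blue edge from `x` to `t` would give the blue C₄ `w`, `t`, `x`, `z`; one from `x′` to `z`,
  -- the blue C₄ `x`, `z`, `x′`, `w`.
  ... | inj₂ xt | _        = ⊥-elim (c4free w≢x (≢-sym z≢t) wt (B-sym xt) xz (B-sym wz))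
  ... | _       | inj₂ x′z = ⊥-elim (c4free x≢x′ z≢w xz (B-sym x′z) (B-sym wx′) wx)
    where
    x≢x′ = All.lookup x∉ (∈-++⁺ˡ (first-∈ p))
    z≢w  = ≢-sym (All.lookup w∉ (∈-++⁺ʳ P (there (first-∈ q))))
  -- The new cycle is `w`, `a`, `x`, `Q` backwards, `P`, `b`.
  ... | inj₁ xt | inj₁ x′z =
    _ , _ , _ , wa ∷ ax ∷ xt ∷ (Path-reverse R-sym q ⟨ R-sym x′z ⟩ p ⟨ ub ⟩ stop) , R-sym wb ,
    ↭-trans
      (solve 6 (λ w a x P b Q → (w ⊕ (a ⊕ (x ⊕ (Q ⊕ (P ⊕ b))))) ⊜ arcs w a (x ⊕ P) b Q) ↭-refl
        [ w ] [ a ] [ x ] P [ b ] (reverse Q))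
      (++⁺ˡ (w ∷ a ∷ x ∷ P) (↭-prep b (↭-reverse Q)))

  -- If w is red to x′ as well, then the successor x″ of x′ takes part in the
  -- reroutings in the way that x and z do.
  insertBetweenLongArcs : Unique (w ∷ (a ∷ x ∷ P) ++ b ∷ Q) → z ≢ t →
    R w a → R w b → R a x → R x x′ → Path R x′ P u → R u b → R b z → Path R z Q t → R t a →
    B w x → B w u → B w z → B w t → B x z →
    HasCycleOn R (w ∷ (a ∷ x ∷ P) ++ b ∷ Q)
  insertBetweenLongArcs {w = w} {a = a} {x = x} {P = P} {b = b} {Q = Q} {x′ = x′}
    uniq@((_ ∷ _ ∷ w∉) ∷ _ ∷ x∉ ∷ PbQ-unique) z≢t wa wb ax xx′ p ub bz q ta wx wu wz wt xz
    with R⊎B (All.lookup w∉ (∈-++⁺ˡ (first-∈ p)))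
  ... | inj₂ wx′ = reverseIntoArc uniq z≢t wa wb ax p ub q wx wz wt wx′ xz
  ... | inj₁ wx′ with p
  -- If `P` is the single vertex `x′`, then `u` is `x′` and `wu` is the blue edge required.
  ...   | stop = reverseIntoArc uniq z≢t wa wb ax stop ub q wx wz wt wu xz
  ...   | _∷_ {xs = P′} x′x″ p′
      with R⊎B (All.lookup w∉ (there (∈-++⁺ˡ (first-∈ p′))))
         | R⊎B (∈-++-≢ PbQ-unique (there (first-∈ p′)) (there (first-∈ q)))
  -- Here `w` fits between `x′` and `x″`.
  ...     | inj₁ wx″ | _ =
      _ , _ , _ , ax ∷ xx′ ∷ R-sym wx′ ∷ wx″ ∷ (p′ ⟨ ub ⟩ bz ∷ q) , ta ,
      shift w (a ∷ x ∷ x′ ∷ []) (P′ ++ b ∷ Q)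
  -- The new cycle is `w`, `b`, `P′` backwards, `Q`, `a`, `x`, `x′`.
  ...     | inj₂ _ | inj₁ x″z =
      _ , _ , _ , wb ∷ R-sym ub ∷ (Path-reverse R-sym p′ ⟨ x″z ⟩ q ⟨ ta ⟩ ax ∷ xx′ ∷ stop) , R-sym wx′ ,
      ↭-trans
        (solve 6 (λ w a X P b Q → (w ⊕ (b ⊕ (P ⊕ (Q ⊕ (a ⊕ X))))) ⊜ arcs w a (X ⊕ P) b Q) ↭-refl
          [ w ] [ a ] (x ∷ x′ ∷ []) (reverse P′) [ b ] Q)
        (++⁺ˡ (w ∷ a ∷ x ∷ x′ ∷ []) (++⁺ʳ (b ∷ Q) (↭-reverse P′)))
  ...     | inj₂ wx″ | inj₂ x″z = ⊥-elim (c4free x≢x″ z≢w xz (B-sym x″z) (B-sym wx″) wx)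
    where
    x≢x″ = All.lookup x∉ (there (∈-++⁺ˡ (first-∈ p′)))
    z≢w  = ≢-sym (All.lookup w∉ (there (∈-++⁺ʳ P′ (there (first-∈ q)))))

  -- The cycle is a, P, b, Q, where P leads from x to u and Q from z to t.
  insertBetweenArcs : 6 ≤ List.length (w ∷ (a ∷ P) ++ b ∷ Q) → Unique (w ∷ (a ∷ P) ++ b ∷ Q) →
    R w a → R w b → R a x → Path R x P u → R u b → R b z → Path R z Q t → R t a →
    HasCycleOn R (w ∷ (a ∷ P) ++ b ∷ Q)
  insertBetweenArcs {w = w} {a = a} {P = P} {b = b} {Q = Q} {x = x} {u = u} {z = z} {t = t}
    6≤ uniq@((_ ∷ w∉) ∷ _ ∷ PbQ-unique) wa wb ax p ub bz q ta
    -- A red edge from `w` to one of `x`, `u`, `z`, `t` lets `w` in beside that vertex. A red `xz`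
    -- or `ut` lets `w` link `a` and `b` once one arc is reversed.
    with R⊎B (All.lookup w∉ (∈-++⁺ˡ (first-∈ p)))
       | R⊎B (All.lookup w∉ (∈-++⁺ˡ (last-∈ p)))
       | R⊎B (All.lookup w∉ (∈-++⁺ʳ P (there (first-∈ q))))
       | R⊎B (All.lookup w∉ (∈-++⁺ʳ P (there (last-∈ q))))
       | R⊎B (∈-++-≢ PbQ-unique (first-∈ p) (there (first-∈ q)))
       | R⊎B (∈-++-≢ PbQ-unique (last-∈ p) (there (last-∈ q)))
  ... | inj₁ wx | _ | _ | _ | _ | _ =
    _ , _ , _ , R-sym wa ∷ wx ∷ (p ⟨ ub ⟩ bz ∷ q) , ta , ↭-swap a w ↭-refl
  ... | inj₂ _ | inj₁ wu | _ | _ | _ | _ =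
    _ , _ , _ , ax ∷ (p ⟨ R-sym wu ⟩ wb ∷ bz ∷ q) , ta , shift w (a ∷ P) (b ∷ Q)
  ... | inj₂ _ | inj₂ _ | inj₁ wz | _ | _ | _ =
    _ , _ , _ , ax ∷ (p ⟨ ub ⟩ R-sym wb ∷ wz ∷ q) , ta ,
    solve 5 (λ w a P b Q → (a ⊕ (P ⊕ (b ⊕ (w ⊕ Q)))) ⊜ arcs w a P b Q) ↭-refl [ w ] [ a ] P [ b ] Q
  ... | inj₂ _ | inj₂ _ | inj₂ _ | inj₁ wt | _ | _ =
    _ , _ , _ , ax ∷ (p ⟨ ub ⟩ bz ∷ (q ⟨ R-sym wt ⟩ stop)) , wa ,
    solve 5 (λ w a P b Q → (a ⊕ (P ⊕ (b ⊕ (Q ⊕ w)))) ⊜ arcs w a P b Q) ↭-refl [ w ] [ a ] P [ b ] Q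
  ... | inj₂ _ | inj₂ _ | inj₂ _ | inj₂ _ | inj₁ xz | _ =
    _ , _ , _ , wb ∷ R-sym ub ∷ (Path-reverse R-sym p ⟨ xz ⟩ q ⟨ ta ⟩ stop) , R-sym wa ,
    ↭-trans
      (solve 5 (λ w a P b Q → (w ⊕ (b ⊕ (P ⊕ (Q ⊕ a)))) ⊜ arcs w a P b Q) ↭-refl
        [ w ] [ a ] (reverse P) [ b ] Q)
      (++⁺ˡ (w ∷ a ∷ []) (++⁺ʳ (b ∷ Q) (↭-reverse P)))
  ... | inj₂ _ | inj₂ _ | inj₂ _ | inj₂ _ | inj₂ _ | inj₁ ut =
    _ , _ , _ , wa ∷ ax ∷ (p ⟨ ut ⟩ Path-reverse R-sym q ⟨ R-sym bz ⟩ stop) , R-sym wb ,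
    ↭-trans
      (solve 5 (λ w a P b Q → (w ⊕ (a ⊕ (P ⊕ (Q ⊕ b)))) ⊜ arcs w a P b Q) ↭-refl
        [ w ] [ a ] P [ b ] (reverse Q))
      (++⁺ˡ (w ∷ a ∷ P) (↭-prep b (↭-reverse Q)))
  ... | inj₂ wx | inj₂ wu | inj₂ wz | inj₂ wt | inj₂ xz | inj₂ ut
      -- All six edges are blue. Two arcs of one vertex each would leave only five vertices in all.
      -- If exactly one arc is a single vertex, then `x` is `u` or `z` is `t`, and the blue edges
      -- already close a C₄.
      with p | q | PbQ-unique | Unique-++⁻ʳ P PbQ-unique
  ...   | stop | stop | _ | _ = contradiction 6≤ λ { (s≤s (s≤s (s≤s (s≤s (s≤s ()))))) }
  ...   | stop | _ ∷ q′ | _ | _ ∷ z∉ ∷ _ =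
    ⊥-elim (c4free (≢-sym (All.lookup w∉ (here refl))) (All.lookup z∉ (last-∈ q′)) xz (B-sym wz) wt (B-sym ut))
  ...   | _ ∷ p′ | stop | x∉ ∷ _ | _ =
    ⊥-elim (c4free (All.lookup x∉ (∈-++⁺ˡ (last-∈ p′)))
      (≢-sym (All.lookup w∉ (∈-++⁺ʳ P (there (here refl))))) xz (B-sym ut) (B-sym wu) wx)
  ...   | xx′ ∷ p′ | _ ∷ q′ | _ | _ ∷ z∉ ∷ _ =
    insertBetweenLongArcs uniq (All.lookup z∉ (last-∈ q′))
      wa wb ax xx′ p′ ub bz q ta wx wu wz wt xz

  -- Start the cycle at `a`. If `b` is next to `a` on it, `w` goes between them; otherwise `a` and
  -- `b` separate two non-empty arcs.
  extendCycle : 6 ≤ List.length (w ∷ xs) → Unique (w ∷ xs) → TwoNeighboursIn R (w ∷ xs) w →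
    HasCycleOn R xs → HasCycleOn R (w ∷ xs)
  extendCycle {w = w} 6≤ uniq (a , b , a∈ , b∈ , a≢b , wa , wb) cyc
    with t , p , path , ta , p↭xs ← cycleFrom cyc (∈-tail a∈ (R⇒≢ wa))
    with cutAt path (∈-resp-↭ (↭-sym p↭xs) (∈-tail b∈ (R⇒≢ wb)))
  ... | inj₁ b≡a = contradiction (sym b≡a) a≢b
  ... | inj₂ (cut stop ab path₂) =
    _ , _ , _ , R-sym wa ∷ wb ∷ path₂ , ta , ↭-trans (↭-swap a w ↭-refl) (↭-prep w p↭xs)
  ... | inj₂ (cut {xs = p₁} path₁ ub stop) =
    _ , _ , _ , (path₁ ⟨ ub ⟩ R-sym wb ∷ stop) , wa ,
    ↭-trans (solve 3 (λ p b w → (p ⊕ (b ⊕ w)) ⊜ (w ⊕ (p ⊕ b))) ↭-refl p₁ [ b ] [ w ]) (↭-prep w p↭xs)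
  ... | inj₂ (cut (ax ∷ path₁) ub (bz ∷ path₂)) =
    HasCycleOn-resp-↭ (↭-prep w p↭xs)
      (insertBetweenArcs
        (subst (6 ≤_) (sym (↭-length (↭-prep w p↭xs))) 6≤) (Unique-resp-↭ (↭-prep w (↭-sym p↭xs)) uniq)
        wa wb ax path₁ ub bz path₂ ta)

-- A sound search for unavoidable monochromatic patterns.

module _ {E : Set} (_≟_ : DecidableEquality E) where

  Pattern : Set
  Pattern = Colour × List E

  Occurs : (E → Colour) → Pattern → Set
  Occurs χ (c , es) = All (λ e → χ e ≡ c) es

  -- Once `e` is known to have colour `c`, it is settled in the patterns of colour `c`, and it rules
  -- out every pattern of the other colour that contains it.
  restrict : E → Colour → List Pattern → List Pattern
  restrict e c [] = []
  restrict e c ((d , es) ∷ ps) =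
    if does (c ≟ᶜ d) then (d , filter (λ e′ → ¬? (e ≟ e′)) es) ∷ restrict e c ps
    else if does (Any.any? (e ≟_) es) then restrict e c ps
    else (d , es) ∷ restrict e c ps

  -- The answer false carries no information: the search may have exhausted its depth n.
  unavoidable : ℕ → List Pattern → Bool
  unavoidable n ps = any (null ∘ proj₂) ps ∨ branch n ps
    where
    branch : ℕ → List Pattern → Bool
    -- Branching on an edge of the first pattern shortens that pattern in one branch and discards it
    -- in the other.
    branch (suc n) ps@((_ , e ∷ _) ∷ _) =
      unavoidable n (restrict e red ps) ∧ unavoidable n (restrict e blue ps)
    branch _ _ = false

  module _ (χ : E → Colour) where

    All-filter⁻ : ∀ {c} e es → χ e ≡ c → Occurs χ (c , filter (λ e′ → ¬? (e ≟ e′)) es) → Occurs χ (c , es)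
    All-filter⁻ e []       _    _  = []
    All-filter⁻ e (e′ ∷ es) χe≡c o with e ≟ e′
    ... | yes refl = χe≡c ∷ All-filter⁻ e es χe≡c o
    ... | no _ with p ∷ o′ ← o = p ∷ All-filter⁻ e es χe≡c o′

    restrict-sound : ∀ e c ps → χ e ≡ c → Any (Occurs χ) (restrict e c ps) → Any (Occurs χ) ps
    restrict-sound e c ((d , es) ∷ ps) χe≡c o with c ≟ᶜ d | does (Any.any? (e ≟_) es)
    restrict-sound e c ((d , es) ∷ ps) χe≡c (here o)  | yes refl | _     = here (All-filter⁻ e es χe≡c o)
    restrict-sound e c ((d , es) ∷ ps) χe≡c (there o) | yes refl | _     = there (restrict-sound e c ps χe≡c o)
    restrict-sound e c ((d , es) ∷ ps) χe≡c o         | no _     | true  = there (restrict-sound e c ps χe≡c o)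
    restrict-sound e c ((d , es) ∷ ps) χe≡c (here o)  | no _     | false = here o
    restrict-sound e c ((d , es) ∷ ps) χe≡c (there o) | no _     | false = there (restrict-sound e c ps χe≡c o)

    -- A pattern with no edges left occurs in every colouring. At a branching, the actual colour of
    -- `e` selects the half of the search to follow.
    unavoidable-sound : ∀ n ps → T (unavoidable n ps) → Any (Occurs χ) ps
    unavoidable-sound n ps t with Equivalence.to (T-∨ {any (null ∘ proj₂) ps}) t
    ... | inj₁ found = Any.map occurs (Any.any⁻ (null ∘ proj₂) ps found)
      where
      occurs : ∀ {p} → T (null (proj₂ p)) → Occurs χ p
      occurs {_ , []} _ = []
    unavoidable-sound (suc n) ps@((_ , e ∷ _) ∷ _) t | inj₂ t′
      with t-red , t-blue ← Equivalence.to (T-∧ {unavoidable n (restrict e red ps)}) t′ with χ e in eq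
    ... | red  = restrict-sound e red ps eq (unavoidable-sound n _ t-red)
    ... | blue = restrict-sound e blue ps eq (unavoidable-sound n _ t-blue)

-- The search over colourings on six vertices.

insertions : (x : A) (xs : List A) → List (∃ (_↭ x ∷ xs))
insertions x []       = (x ∷ [] , ↭-refl) ∷ []
insertions x (y ∷ xs) = (x ∷ y ∷ xs , ↭-refl) ∷
  map (λ (zs , σ) → y ∷ zs , ↭-trans (↭-prep y σ) (↭-swap y x ↭-refl)) (insertions x xs)

-- Each arrangement carries its proof, from which a red cycle found by the search is known to pass
-- through every vertex.
permutations : (xs : List A) → List (∃ (_↭ xs))
permutations []       = ([] , ↭-refl) ∷ []
permutations (x ∷ xs) = concatMap
  (λ (ys , σ) → map (λ (zs , τ) → zs , ↭-trans τ (↭-prep x σ)) (insertions x ys)) (permutations xs)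

V E₆ : Set
V  = Fin 6
E₆ = V × V

_≟ₑ_ : DecidableEquality E₆
(i , j) ≟ₑ (k , l) =
  map′ (λ (i≡k , j≡l) → cong₂ _,_ (Fin.toℕ-injective i≡k) (Fin.toℕ-injective j≡l))
       (λ { refl → refl , refl })
       ((toℕ i ℕ.≟ toℕ k) ×-dec (toℕ j ℕ.≟ toℕ l))

-- Ordering the ends gives each undirected edge a single name, so that the search branches on it
-- only once.
edge : V → V → E₆
edge i j = if does (i Fin.≤? j) then (i , j) else (j , i)

walkEdges : V → List V → V → List E₆
walkEdges x []       z = edge x z ∷ []
walkEdges x (y ∷ ys) z = edge x y ∷ walkEdges y ys z

-- blueStar v y says that v is blue to all vertices other than v and y.
data Configuration : Set where
  redCycle : (p : List V) → p ↭ List.tabulate {n = 5} suc → Configuration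
  blueC4   : (a b c d : V) → Unique (a ∷ b ∷ c ∷ d ∷ []) → Configuration
  blueStar : V → V → Configuration

patternOf : Configuration → Pattern _≟ₑ_
patternOf (redCycle p _)     = red  , walkEdges zero p zero
patternOf (blueC4 a b c d _) = blue , walkEdges a (b ∷ c ∷ d ∷ []) a
patternOf (blueStar v y)     = blue , map (edge v) (filter (λ z → ¬? (v Fin.≟ z) ×-dec ¬? (y Fin.≟ z)) (allFin 6))

-- The inequalities select one representative of each cycle up to rotation and
-- reflection, which keeps the search short.
configurations : List Configuration
configurations =
  concatMap (λ a → concatMap (λ b → concatMap (λ c → concatMap (λ d → c4 a b c d)
    (allFin 6)) (allFin 6)) (allFin 6)) (allFin 6) ++
  cartesianProductWith blueStar (allFin 6) (allFin 6) ++
  concatMap c6 (permutations (List.tabulate {n = 5} suc))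
  where
  c4 : V → V → V → V → List Configuration
  c4 a b c d with unique? (Fin._≟_ {6}) (a ∷ b ∷ c ∷ d ∷ [])
                | (a Fin.<? b) ×-dec (a Fin.<? c) ×-dec (b Fin.<? d)
  ... | yes u | yes _ = blueC4 a b c d u ∷ []
  ... | _     | _     = []
  c6 : ∃ (_↭ List.tabulate {n = 5} suc) → List Configuration
  c6 (p@(x ∷ _ ∷ _ ∷ _ ∷ y ∷ []) , σ) = if does (x Fin.<? y) then redCycle p σ ∷ [] else []
  c6 _ = []

-- Abstract, so that the search is not rerun when the result is used.
abstract
  configuration-unavoidable : (χ : E₆ → Colour) → Any (Occurs _≟ₑ_ χ ∘ patternOf) configurations
  configuration-unavoidable χ =
    -- Each branching settles one of the 15 edges on six vertices, hence the depth. That `tt` is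
    -- accepted is the outcome of the search.
    Any.map⁻ {f = patternOf} {xs = configurations} (unavoidable-sound _≟ₑ_ χ 15 (map patternOf configurations) tt)

-- Red Hamiltonian cycles on six vertices.

Path-map : ∀ {R : Rel A 0ℓ} (f : C → A) → Path (R on f) x xs t → Path R (f x) (map f xs) (f t)
Path-map f stop    = stop
Path-map f (e ∷ p) = e ∷ Path-map f p

module _ (K : TwoColouring V) (c4free : C4Free (TwoColouring.B K))
         (two : ∀ w → TwoNeighboursIn (TwoColouring.R K) (allFin 6) w) where

  open TwoColouring K

  χ : E₆ → Colour
  χ (i , j) = if does (R? i j) then red else blue

  χ-red : ∀ i j → χ (edge i j) ≡ red → R i j
  χ-red i j eq with does (i Fin.≤? j)
  ... | true  with R? i j
  ...   | yes r = r
  χ-red i j eq | false with R? j i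
  ...   | yes r = R-sym r

  χ-blue : ∀ i j → χ (edge i j) ≡ blue → ¬ R i j
  χ-blue i j eq with does (i Fin.≤? j)
  ... | true  with R? i j
  ...   | no ¬r = ¬r
  χ-blue i j eq | false with R? j i
  ...   | no ¬r = ¬r ∘ R-sym

  χ-blue′ : ∀ {i j} → i ≢ j → χ (edge i j) ≡ blue → B i j
  χ-blue′ i≢j eq = ¬R⇒B i≢j (χ-blue _ _ eq)

  redWalk : ∀ x ys z → All (λ e → χ e ≡ red) (walkEdges x ys z) →
            ∃[ y ] Path R x (x ∷ ys) y × R y z
  redWalk x []       z (e ∷ []) = x , stop , χ-red x z e
  redWalk x (y ∷ ys) z (e ∷ es) with u , p , uz ← redWalk y ys z es = u , χ-red x y e ∷ p , uz

  -- Of the three kinds of configuration, a blue C₄ is excluded by hypothesis, and a blue star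
  -- because one of the two red neighbours of its centre `v` differs from `y`.
  hamiltonian₆ : HasCycleOn R (allFin 6)
  hamiltonian₆ with Any.satisfied (configuration-unavoidable χ)
  ... | redCycle p σ , occ with y , path , e ← redWalk zero p zero occ =
    zero , y , zero ∷ p , path , e , ↭-prep zero σ
  ... | blueC4 a b c d ((a≢b ∷ a≢c ∷ a≢d ∷ []) ∷ (b≢c ∷ b≢d ∷ []) ∷ (c≢d ∷ []) ∷ _)
      , (ab ∷ bc ∷ cd ∷ da ∷ []) =
    ⊥-elim (c4free a≢c b≢d (χ-blue′ a≢b ab) (χ-blue′ b≢c bc) (χ-blue′ c≢d cd) (χ-blue′ (≢-sym a≢d) da))
  ... | blueStar v y , occ with s , t , _ , _ , s≢t , vs , vt ← two v = ⊥-elim (notBoth (y Fin.≟ s))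
    where
    notRed : ∀ {z} → y ≢ z → ¬ R v z
    notRed {z} y≢z vz = χ-blue v z
      (All.lookup occ (∈-map⁺ (edge v)
        (∈-filter⁺ (λ z → ¬? (v Fin.≟ z) ×-dec ¬? (y Fin.≟ z)) (∈-allFin z) (R⇒≢ vz , y≢z)))) vz
    notBoth : ¬ Dec (y ≡ s)
    notBoth (yes refl) = notRed s≢t vt
    notBoth (no y≢s)   = notRed y≢s vs

TwoNeighboursIn-lookup : ∀ {R : Rel A 0ℓ} L {i} → TwoNeighboursIn R L (lookup L i) →
                         TwoNeighboursIn (R on lookup L) (allFin (List.length L)) i
TwoNeighboursIn-lookup {R = R} L (a , b , a∈ , b∈ , a≢b , wa , wb) =
  Any.index a∈ , Any.index b∈ , ∈-allFin _ , ∈-allFin _ ,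
  (λ eq → a≢b (trans (Any.lookup-index a∈) (trans (cong (lookup L) eq) (sym (Any.lookup-index b∈))))) ,
  subst (R _) (Any.lookup-index a∈) wa , subst (R _) (Any.lookup-index b∈) wb

-- The induction on the number of vertices.

module _ (K : TwoColouring A) (c4free : C4Free (TwoColouring.B K)) (_≟_ : DecidableEquality A) where

  open TwoColouring K

  hamiltonianOnSix : ∀ {L} → List.length L ≡ 6 → Unique L → (∀ {w} → w ∈ˡ L → TwoNeighboursIn R L w) → HasCycleOn R L
  -- With six entries displayed, `map (lookup L) (allFin 6)` computes to `L`.
  hamiltonianOnSix {L@(_ ∷ _ ∷ _ ∷ _ ∷ _ ∷ _ ∷ [])} refl uniq two
    with _ , _ , p , path , e , σ ← hamiltonian₆ (pullback (lookup L) (lookup-injective uniq) K)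
           (λ i≢k j≢l → c4free (i≢k ∘ lookup-injective uniq) (j≢l ∘ lookup-injective uniq))
           (λ w → TwoNeighboursIn-lookup {R = R} L {w} (two (∈-lookup {xs = L} w))) =
    _ , _ , map (lookup L) p , Path-map (lookup L) path , e , ↭.map⁺ (lookup L) σ

  -- The exception `y` may be `w` itself, which covers the case of no red neighbour.
  NearlyAllBlue : List A → A → Set
  NearlyAllBlue L w = ∃[ y ] ∀ {z} → z ∈ˡ L → w ≢ z → y ≢ z → B w z

  twoNeighbours⊎nearlyAllBlue : ∀ L w → TwoNeighboursIn R L w ⊎ NearlyAllBlue L w
  twoNeighbours⊎nearlyAllBlue L w with Any.any? (R? w) L
  ... | no none = inj₂ (w , λ z∈ w≢z _ → ¬R⇒B w≢z (none ∘ lose z∈))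
  ... | yes some with y , y∈ , wy ← find some with Any.any? (λ z → ¬? (y ≟ z) ×-dec R? w z) L
  ...   | no none = inj₂ (y , λ z∈ w≢z y≢z → ¬R⇒B w≢z (λ wz → none (lose z∈ (y≢z , wz))))
  ...   | yes another with z , z∈ , y≢z , wz ← find another = inj₁ (y , z , y∈ , z∈ , y≢z , wy , wz)

  -- A simultaneous induction: `hamiltonian` at `suc k` uses `cycleMissingOne` at `k`, which deletes
  -- a vertex and applies `cycleOn⊎nearlyAllBlue` at `k`, and this in turn rests on `hamiltonian` at
  -- `k`.
  cycleOn⊎nearlyAllBlue : ∀ k {L} → Unique L → List.length L ≡ 6 + k →
    HasCycleOn R L ⊎ (∃[ v ] v ∈ˡ L × NearlyAllBlue L v)
  hamiltonian : ∀ k {L} → Unique L → List.length L ≡ 6 + k →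
    (∀ {w} → w ∈ˡ L → TwoNeighboursIn R L w) → HasCycleOn R L
  cycleMissingOne : ∀ k {L} → Unique L → List.length L ≡ 7 + k →
    ∃[ w ] ∃[ L′ ] L ↭ w ∷ L′ × HasCycleOn R L′

  cycleOn⊎nearlyAllBlue k {L} u len with All.decide (twoNeighbours⊎nearlyAllBlue L) L
  ... | inj₁ two  = inj₁ (hamiltonian k u len (All.lookup two))
  ... | inj₂ some = inj₂ (find some)

  hamiltonian zero    u len two = hamiltonianOnSix len u two
  hamiltonian (suc k) u len two with w , L′ , σ , cyc ← cycleMissingOne k u len =
    HasCycleOn-resp-↭ (↭-sym σ)
      (extendCycle K c4free (subst (6 ≤_) (↭-length σ) (subst (6 ≤_) (sym len) (ℕ.m≤m+n 6 (suc k))))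
        (Unique-resp-↭ σ u)
        (let a , b , a∈ , b∈ , ab = two (∈-resp-↭ (↭-sym σ) (here refl))
         in a , b , ∈-resp-↭ σ a∈ , ∈-resp-↭ σ b∈ , ab)
        cyc)

  cycleMissingOne k {w ∷ L} (w∉ ∷ u) len with cycleOn⊎nearlyAllBlue k u (ℕ.suc-injective len)
  ... | inj₁ cyc = w , L , ↭-refl , cyc
  -- Deleting `v` instead of `w` ensures that the second such vertex, `v′`, differs from `v`.
  ... | inj₂ (v , v∈ , y , v-blue) with L′ , σ ← ∈⇒↭∷ {xs = w ∷ L} (there v∈)
      with v∉ ∷ u′ ← Unique-resp-↭ σ (w∉ ∷ u)
      with cycleOn⊎nearlyAllBlue k u′ (ℕ.suc-injective (trans (sym (↭-length σ)) len))
  ...   | inj₁ cyc = v , L′ , σ , cyc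
  ...   | inj₂ (v′ , v′∈ , y′ , v′-blue)
        -- Out of at least seven vertices, `c` has five to avoid and `d` six: the deleted vertices
        -- `w` and `v`, the vertex `v′`, both exceptions, and for `d` also `c`. Then `v`, `c`, `v′`,
        -- `d` is a blue C₄.
        with c , c∈ , (w≢c ∷ v≢c ∷ y≢c ∷ v′≢c ∷ y′≢c ∷ []) ←
               ∃∉ _≟_ (w ∷ v ∷ y ∷ v′ ∷ y′ ∷ []) (w∉ ∷ u) (subst (5 <_) (sym len) (ℕ.m≤n⇒m≤1+n (ℕ.m≤m+n 6 k)))
        with d , d∈ , (c≢d ∷ w≢d ∷ v≢d ∷ y≢d ∷ v′≢d ∷ y′≢d ∷ []) ←
               ∃∉ _≟_ (c ∷ w ∷ v ∷ y ∷ v′ ∷ y′ ∷ []) (w∉ ∷ u) (subst (6 <_) (sym len) (ℕ.m≤m+n 7 k)) =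
    ⊥-elim (c4free (All.lookup v∉ v′∈) c≢d
      (v-blue (∈-tail c∈ w≢c) v≢c y≢c)
      (B-sym (v′-blue (∈-tail (∈-resp-↭ σ c∈) v≢c) v′≢c y′≢c))
      (v′-blue (∈-tail (∈-resp-↭ σ d∈) v≢d) v′≢d y′≢d)
      (B-sym (v-blue (∈-tail d∈ w≢d) v≢d y≢d)))

-- Cycles as subgraphs of a red-blue graph.

twoColouring : RedBlueGraph N → TwoColouring (Fin N)
twoColouring {N} G = record
  { R        = Adj (redSubgraph G)
  ; B        = Adj (blueSubgraph G)
  ; R-sym    = adj-sym (redSubgraph G)
  ; B-sym    = adj-sym (blueSubgraph G)
  ; R-irrefl = adj-irrefl (redSubgraph G)
  ; R?       = adj? (redSubgraph G)
  ; R⊎B      = red⊎blue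
  }
  where
  red⊎blue : ∀ {x y} → x ≢ y → Adj (redSubgraph G) x y ⊎ Adj (blueSubgraph G) x y
  red⊎blue {x} {y} x≢y with colour G x y
  ... | red  = inj₁ (x≢y , refl)
  ... | blue = inj₂ (x≢y , refl)

module _ {R : Rel A 0ℓ} where

  Path-lookup-suc : Path R x xs t → ∀ {i j} → toℕ j ≡ suc (toℕ i) → R (lookup xs i) (lookup xs j)
  Path-lookup-suc stop          {zero}  {zero} ()
  Path-lookup-suc (e ∷ stop)    {zero}  {suc zero}    eq = e
  Path-lookup-suc (e ∷ _ ∷ _)   {zero}  {suc zero}    eq = e
  Path-lookup-suc (_ ∷ p)       {suc i} {suc j}       eq = Path-lookup-suc p (ℕ.suc-injective eq)

  Path-lookup-first : Path R x xs t → ∀ {i} → toℕ i ≡ 0 → lookup xs i ≡ x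
  Path-lookup-first stop    {zero} _ = refl
  Path-lookup-first (_ ∷ _) {zero} _ = refl

  Path-lookup-last : Path R x xs t → ∀ {i} → suc (toℕ i) ≡ List.length xs → lookup xs i ≡ t
  Path-lookup-last stop          {zero}  _  = refl
  Path-lookup-last (_ ∷ stop)    {zero}  ()
  Path-lookup-last (_ ∷ _ ∷ _)   {zero}  ()
  Path-lookup-last (_ ∷ p)       {suc i} eq = Path-lookup-last p (ℕ.suc-injective eq)

-- The list itself is the embedding, position by position; the edge `tx` serves the step that wraps
-- round.
cycle⊑ : ∀ (H : Graph N) (C : Cycle) → Path (Adj H) x xs t → Adj H t x → Unique xs →
         List.length xs ≡ length C → cycleGraph C ⊑ H
cycle⊑ {x = x} {xs = xs} {t = t} H (cycle _ 3≤) p tx u refl = record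
  { embed     = lookup xs
  ; injective = lookup-injective u
  ; preserves = λ { (inj₁ ij) → step ij ; (inj₂ ji) → adj-sym H (step ji) }
  }
  where
  step : ∀ {i j} → CyclicSuc i j → Adj H (lookup xs i) (lookup xs j)
  step (inj₁ j≡1+i) = Path-lookup-suc p j≡1+i
  step (inj₂ (1+i≡k , j≡0)) =
    subst₂ (Adj H) (sym (Path-lookup-last p 1+i≡k)) (sym (Path-lookup-first p j≡0)) tx

HasCycleOn⇒⊑ : ∀ (H : Graph N) (C : Cycle) → Unique xs → List.length xs ≡ length C →
               HasCycleOn (Adj H) xs → cycleGraph C ⊑ H
HasCycleOn⇒⊑ H C u len (_ , _ , _ , path , tx , p↭xs) =
  cycle⊑ H C path tx (Unique-resp-↭ (↭-sym p↭xs) u) (trans (↭-length p↭xs) len)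

C4 : Graph N → Set
C4 H = ∃[ s ] ∃[ t ] ∃[ u ] ∃[ v ]
  s ≢ u × t ≢ v × Adj H s t × Adj H t u × Adj H u v × Adj H v s

C4? : (H : Graph N) → Dec (C4 H)
C4? H = Fin.any? λ s → Fin.any? λ t → Fin.any? λ u → Fin.any? λ v →
  ¬? (s Fin.≟ u) ×-dec ¬? (t Fin.≟ v) ×-dec adj? H s t ×-dec adj? H t u ×-dec adj? H u v ×-dec adj? H v s

¬C4⇒C4Free : (H : Graph N) → ¬ C4 H → C4Free (Adj H)
¬C4⇒C4Free H ¬c4 s≢u t≢v st tu uv vs = ¬c4 (_ , _ , _ , _ , s≢u , t≢v , st , tu , uv , vs)

Adj⇒≢ : (H : Graph N) → Adj H x t → x ≢ t
Adj⇒≢ H e refl = adj-irrefl H _ e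

C4⇒⊑ : (H : Graph N) (C : Cycle) → length C ≡ 4 → C4 H → cycleGraph C ⊑ H
C4⇒⊑ H C len (s , t , u , v , s≢u , t≢v , st , tu , uv , vs) = cycle⊑ H C
  (st ∷ tu ∷ uv ∷ stop) vs
  ((Adj⇒≢ H st ∷ s≢u ∷ ≢-sym (Adj⇒≢ H vs) ∷ []) ∷ (Adj⇒≢ H tu ∷ t≢v ∷ []) ∷ (Adj⇒≢ H uv ∷ []) ∷ [] ∷ [])
  (sym len)

-- Cyclic successors

next : 3 ≤ k → (i : Fin k) → ∃[ j ] CyclicSuc i j
next {k} 3≤k i with ℕ.m≤n⇒m<n∨m≡n (toℕ<n i)
... | inj₁ 1+i<k = fromℕ< 1+i<k , inj₁ (toℕ-fromℕ< 1+i<k)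
... | inj₂ 1+i≡k = fromℕ< 0<k , inj₂ (1+i≡k , toℕ-fromℕ< 0<k)
  where 0<k = ℕ.<-≤-trans z<s 3≤k

previous : (j : Fin k) → ∃[ i ] CyclicSuc i j
previous {suc k} zero    = fromℕ< (ℕ.n<1+n k) , inj₂ (cong suc (toℕ-fromℕ< _) , refl)
previous {suc k} (suc j) = inject₁ j , inj₁ (cong suc (sym (toℕ-inject₁ j)))

-- Without a wrap positions strictly increase, and a return that wraps forces `k` to be at most the
-- number of steps. `cyclicSuc³-irrefl` holds for the same reason.
cyclicSuc²-irrefl : 3 ≤ k → {i j : Fin k} → CyclicSuc i j → ¬ CyclicSuc j i
cyclicSuc²-irrefl 3≤k {i} {j} (inj₁ p) (inj₁ q) rewrite p = contradiction q (ℕ.<⇒≢ (s≤s (ℕ.n≤1+n _)))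
cyclicSuc²-irrefl 3≤k (inj₁ p) (inj₂ (q , r)) rewrite r | p | sym q with s≤s (s≤s ()) ← 3≤k
cyclicSuc²-irrefl 3≤k (inj₂ (q , r)) (inj₁ p) rewrite r | p | sym q with s≤s (s≤s ()) ← 3≤k
cyclicSuc²-irrefl 3≤k (inj₂ (q , r)) (inj₂ (p , s)) rewrite r | sym p with s≤s () ← 3≤k

cyclicSuc³-irrefl : 4 ≤ k → {i j l : Fin k} → CyclicSuc i j → CyclicSuc j l → ¬ CyclicSuc l i
cyclicSuc³-irrefl 4≤k {i} (inj₁ p) (inj₁ q) (inj₁ r) rewrite q | p = contradiction r (ℕ.<⇒≢ (ℕ.m≤n+m (suc (toℕ i)) 2))
cyclicSuc³-irrefl 4≤k (inj₁ p) (inj₁ q) (inj₂ (r , s)) rewrite q | p | s | sym r with s≤s (s≤s (s≤s ())) ← 4≤k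
cyclicSuc³-irrefl 4≤k (inj₁ p) (inj₂ (q , s)) (inj₁ r) rewrite s | r | p | sym q with s≤s (s≤s (s≤s ())) ← 4≤k
cyclicSuc³-irrefl 4≤k (inj₁ p) (inj₂ (q , s)) (inj₂ (r , t)) rewrite s | sym r with s≤s () ← 4≤k
cyclicSuc³-irrefl 4≤k (inj₂ (p , s)) (inj₁ q) (inj₁ r) rewrite s | q | r | sym p with s≤s (s≤s (s≤s ())) ← 4≤k
cyclicSuc³-irrefl 4≤k (inj₂ (p , s)) (inj₁ q) (inj₂ (r , t)) rewrite t | sym p with s≤s () ← 4≤k
cyclicSuc³-irrefl 4≤k (inj₂ (p , s)) (inj₂ (q , t)) r rewrite s | sym q with s≤s () ← 4≤k

module _ (H : Graph N) (C : Cycle) (C⊑H : cycleGraph C ⊑ H) where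
  open _⊑_ C⊑H

  private
    twoSteps-≢ : ∀ {i j l} → CyclicSuc i j → CyclicSuc j l → embed i ≢ embed l
    twoSteps-≢ ij jl eq with refl ← injective eq = cyclicSuc²-irrefl (3≤length C) ij jl

  twoNeighboursOnCycle : ∀ j → ∃[ s ] ∃[ t ] s ≢ t × Adj H (embed j) s × Adj H (embed j) t
  twoNeighboursOnCycle j with i , ij ← previous j | l , jl ← next (3≤length C) j =
    embed i , embed l , twoSteps-≢ ij jl , preserves (inj₂ ij) , preserves (inj₁ jl)

  -- On a cycle through `v`, the three vertices after `v` serve, and length at least 4 keeps the
  -- third from being `v` again. On any other cycle three consecutive vertices do.
  pathOnCycleAvoiding : 4 ≤ length C → ∀ v → ∃[ i ] ∃[ j ] ∃[ l ]
    embed i ≢ v × embed j ≢ v × embed l ≢ v × embed i ≢ embed l × Adj H (embed j) (embed i) × Adj H (embed j) (embed l)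
  pathOnCycleAvoiding 4≤C v with Fin.any? (λ h → embed h Fin.≟ v)
  ... | yes (h , refl)
      with i , hi ← next (3≤length C) h
      with j , ij ← next (3≤length C) i
      with l , jl ← next (3≤length C) j =
    i , j , l , ≢-sym (Adj⇒≢ H (preserves (inj₁ hi))) , ≢-sym (twoSteps-≢ hi ij) ,
    (λ eq → threeSteps hi ij jl (injective (sym eq))) ,
    twoSteps-≢ ij jl , preserves (inj₂ ij) , preserves (inj₁ jl)
    where
    threeSteps : ∀ {h i j l} → CyclicSuc h i → CyclicSuc i j → CyclicSuc j l → h ≢ l
    threeSteps hi ij jl refl = cyclicSuc³-irrefl 4≤C hi ij jl
  ... | no missing
      with i , _ ← next (3≤length C) (fromℕ< (ℕ.<-≤-trans z<s (3≤length C)))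
      with j , ij ← next (3≤length C) i
      with l , jl ← next (3≤length C) j =
    i , j , l , (λ eq → missing (i , eq)) , (λ eq → missing (j , eq)) , (λ eq → missing (l , eq)) ,
    twoSteps-≢ ij jl , preserves (inj₂ ij) , preserves (inj₁ jl)

-- Graphs that avoid both sets of cycles.

-- If `v` were missed, `punchOut` at `v` would give an injection into a set with one element fewer.
injective⇒surjective : {f : Fin k → Fin n} → Injective _≡_ _≡_ f → n ≤ k → ∀ v → ∃[ i ] f i ≡ v
injective⇒surjective {n = suc n} {f = f} f-inj n≤k v with Fin.any? (λ i → f i Fin.≟ v)
... | yes hit = hit
... | no miss = contradiction (ℕ.≤-trans n≤k (injective⇒≤ g-inj)) ℕ.1+n≰n
  where
  v≢ : ∀ i → v ≢ f i
  v≢ i eq = miss (i , sym eq)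
  g-inj : Injective _≡_ _≡_ (λ i → punchOut (v≢ i))
  g-inj eq = f-inj (punchOut-injective (v≢ _) (v≢ _) eq)

-- What the members of 𝒢₁, 𝒢₂ and 𝒢₃ have in common; the vertices that are
-- neither the centre nor Matched are pendant, hence on no cycle.
record NearlyFriendship (H : Graph N) : Set₁ where
  field
    centre       : Fin N
    nonNeighbour : ∀ {s t} → s ≢ centre → t ≢ centre → ¬ Adj H centre s → ¬ Adj H centre t → s ≡ t
    Matched      : Pred (Fin N) 0ℓ
    cover        : ∀ z → z ≡ centre ⊎ Matched z ⊎ (∀ {s t} → Adj H z s → Adj H z t → s ≡ t)
    matching     : ∀ {u s t} → Matched u → Matched s → Matched t → Adj H u s → Adj H u t → s ≡ t

module _ {G : RedBlueGraph N} (shape : NearlyFriendship (blueSubgraph G)) where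
  open NearlyFriendship shape

  -- Every vertex of a cycle other than the centre is `Matched`, since a pendant vertex has only one
  -- neighbour. The middle of a three-vertex path that avoids the centre then has two matched
  -- neighbours.
  noBlueCycle : ∀ C → 4 ≤ length C → ¬ cycleGraph C ⊑ blueSubgraph G
  noBlueCycle C 4≤C C⊑
    with i , j , l , i≢ , j≢ , l≢ , i≢l , ji , jl ←
           pathOnCycleAvoiding (blueSubgraph G) C C⊑ 4≤C centre =
    i≢l (matching (matched j≢) (matched i≢) (matched l≢) ji jl)
    where
    open _⊑_ C⊑
    matched : ∀ {i} → embed i ≢ centre → Matched (embed i)
    matched {i} i≢ with cover (embed i)
    ... | inj₁ i≡ = contradiction i≡ i≢
    ... | inj₂ (inj₁ m) = m
    ... | inj₂ (inj₂ pendant)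
        with s , t , s≢t , is , it ← twoNeighboursOnCycle (blueSubgraph G) C C⊑ i =
      contradiction (pendant is it) s≢t

  -- So long a cycle is spanning, hence meets the centre, which has at most one red neighbour.
  noRedCycle : ∀ C → N ≤ length C → ¬ cycleGraph C ⊑ redSubgraph G
  noRedCycle C N≤C C⊑
    with i , i≡centre ← injective⇒surjective (_⊑_.injective C⊑) N≤C centre
    with s , t , s≢t , is , it ← twoNeighboursOnCycle (redSubgraph G) C C⊑ i =
    s≢t (nonNeighbour (s≢ is) (s≢ it) (¬blue is) (¬blue it))
    where
    open _⊑_ C⊑
    s≢ : ∀ {s} → Adj (redSubgraph G) (embed i) s → s ≢ centre
    s≢ (i≢s , _) s≡ = i≢s (trans i≡centre (sym s≡))
    ¬blue : ∀ {s} → Adj (redSubgraph G) (embed i) s → ¬ Adj (blueSubgraph G) centre s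
    ¬blue (_ , is) (_ , vs) with () ← trans (sym is) (trans (cong (λ u → colour G u _) i≡centre) vs)

NearlyFriendship-resp-≅ : {G : Graph N} {H : Graph n} → G ≅ H → NearlyFriendship H → NearlyFriendship G
NearlyFriendship-resp-≅ {G = G} {H = H} G≅H shape = record
  { centre       = from centre
  ; nonNeighbour = λ s≢ t≢ ¬s ¬t → to-inj (nonNeighbour (moved s≢) (moved t≢) (¬adj ¬s) (¬adj ¬t))
  ; Matched      = Matched ∘ to
  ; cover        = cover′
  ; matching     = λ mu ms mt us ut → to-inj (matching mu ms mt (adj us) (adj ut))
  }
  where
  open _≅_ G≅H
  open Inverse bijection using (to; from; strictlyInverseˡ; strictlyInverseʳ)
  open NearlyFriendship shape
  to-inj : ∀ {s t} → to s ≡ to t → s ≡ t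
  to-inj = Injection.injective (↔⇒↣ bijection)
  adj : ∀ {s t} → Adj G s t → Adj H (to s) (to t)
  adj = Equivalence.to (adj⇔ _ _)
  moved : ∀ {s} → s ≢ from centre → to s ≢ centre
  moved s≢ eq = s≢ (trans (sym (strictlyInverseʳ _)) (cong from eq))
  ¬adj : ∀ {s} → ¬ Adj G (from centre) s → ¬ Adj H centre (to s)
  ¬adj ¬s vs = ¬s (Equivalence.from (adj⇔ _ _) (subst (λ c → Adj H c _) (sym (strictlyInverseˡ centre)) vs))
  cover′ : ∀ z → z ≡ from centre ⊎ Matched (to z) ⊎ (∀ {s t} → Adj G z s → Adj G z t → s ≡ t)
  cover′ z with cover (to z)
  ... | inj₁ z≡ = inj₁ (trans (sym (strictlyInverseʳ z)) (cong from z≡))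
  ... | inj₂ (inj₁ m) = inj₂ (inj₁ m)
  ... | inj₂ (inj₂ pendant) = inj₂ (inj₂ λ zs zt → to-inj (pendant (adj zs) (adj zt)))

-- The colouring for the lower bound on the Ramsey number: the centre has no red edge, and no blue
-- edge misses the centre.
star : RedBlueGraph (suc N)
star = record { colour = c ; colour-sym = c-sym }
  where
  c : Fin (suc N) → Fin (suc N) → Colour
  c zero    _       = blue
  c (suc _) zero    = blue
  c (suc _) (suc _) = red
  c-sym : ∀ u v → c u v ≡ c v u
  c-sym zero    zero    = refl
  c-sym zero    (suc _) = refl
  c-sym (suc _) zero    = refl
  c-sym (suc _) (suc _) = refl

star-shape : NearlyFriendship (blueSubgraph (star {N}))
star-shape = record
  { centre       = zero
  ; nonNeighbour = λ s≢ _ ¬s _ → contradiction (≢-sym s≢ , refl) ¬s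
  ; Matched      = _≢ zero
  ; cover        = λ { zero → inj₁ refl ; (suc _) → inj₂ (inj₁ λ ()) }
  ; matching     = λ {u} {s} → leaf u s
  }
  where
  leaf : ∀ u s {t} → u ≢ zero → s ≢ zero → t ≢ zero → Adj (blueSubgraph star) u s → Adj (blueSubgraph star) u t → s ≡ t
  leaf zero    s       u≢ s≢ t≢ us ut = contradiction refl u≢
  leaf (suc _) zero    u≢ s≢ t≢ us ut = contradiction refl s≢
  leaf (suc _) (suc _) u≢ s≢ t≢ (_ , ()) ut

-- Cardinalities of subsets

∣p∣≤1⇒≡ : {p : Subset n} → ∣ p ∣ ≤ 1 → ∀ {s t} → s ∈ p → t ∈ p → s ≡ t
∣p∣≤1⇒≡ {p = p} ∣p∣≤1 {s} {t} s∈ t∈ = decidable-stable (s Fin.≟ t) λ s≢t →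
  ℕ.<⇒≱ (ℕ.<-≤-trans (s≤s (ℕ.≤-<-trans z≤n (x∈p⇒∣p-x∣<∣p∣ (x∈p∧x≢y⇒x∈p-y t∈ (≢-sym s≢t))))) (x∈p⇒∣p-x∣<∣p∣ s∈)) ∣p∣≤1

≡⇒∣p∣≤1 : (p : Subset n) → (∀ {s t} → s ∈ p → t ∈ p → s ≡ t) → ∣ p ∣ ≤ 1
≡⇒∣p∣≤1 {n = n} p unique with nonempty? p
... | no empty = subst (_≤ 1) (sym (trans (cong ∣_∣ (Empty-unique empty)) (∣⊥∣≡0 n))) z≤n
... | yes (x , x∈) =
  subst (∣ p ∣ ≤_) (∣⁅x⁆∣≡1 x) (p⊆q⇒∣p∣≤∣q∣ λ {y} y∈ → subst (_∈ ⁅ x ⁆) (unique x∈ y∈) (x∈⁅x⁆ x))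

∣p∪⁅x⁆∣≤1+∣p∣ : (p : Subset n) (x : Fin n) → ∣ p ∪ ⁅ x ⁆ ∣ ≤ suc ∣ p ∣
∣p∪⁅x⁆∣≤1+∣p∣ (s Vec.∷ p) zero rewrite ∪-identityʳ p with s
... | inside  = ℕ.n≤1+n _
... | outside = ℕ.≤-refl
∣p∪⁅x⁆∣≤1+∣p∣ (inside  Vec.∷ p) (suc x) = s≤s (∣p∪⁅x⁆∣≤1+∣p∣ p x)
∣p∪⁅x⁆∣≤1+∣p∣ (outside Vec.∷ p) (suc x) = ∣p∪⁅x⁆∣≤1+∣p∣ p x

∣p∣≡3 : {p : Subset n} {a b c : Fin n} → a ≢ b → a ≢ c → b ≢ c → a ∈ p → b ∈ p → c ∈ p →
        (∀ {z} → z ∈ p → z ≡ a ⊎ z ≡ b ⊎ z ≡ c) → ∣ p ∣ ≡ 3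
∣p∣≡3 {p = p} {a} {b} {c} a≢b a≢c b≢c a∈ b∈ c∈ only = ℕ.≤-antisym
  (ℕ.≤-trans (p⊆q⇒∣p∣≤∣q∣ p⊆) (ℕ.≤-trans (∣p∪⁅x⁆∣≤1+∣p∣ (⁅ a ⁆ ∪ ⁅ b ⁆) c)
    (s≤s (ℕ.≤-trans (∣p∪⁅x⁆∣≤1+∣p∣ ⁅ a ⁆ b) (s≤s (ℕ.≤-reflexive (∣⁅x⁆∣≡1 a)))))))
  (ℕ.≤-trans (s≤s (ℕ.≤-trans (s≤s (ℕ.≤-<-trans z≤n (x∈p⇒∣p-x∣<∣p∣ c∈′))) (x∈p⇒∣p-x∣<∣p∣ b∈′))) (x∈p⇒∣p-x∣<∣p∣ a∈))
  where
  b∈′ : b ∈ p - a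
  b∈′ = x∈p∧x≢y⇒x∈p-y b∈ (≢-sym a≢b)
  c∈′ : c ∈ p - a - b
  c∈′ = x∈p∧x≢y⇒x∈p-y (x∈p∧x≢y⇒x∈p-y c∈ (≢-sym a≢c)) (≢-sym b≢c)
  p⊆ : p ⊆ (⁅ a ⁆ ∪ ⁅ b ⁆) ∪ ⁅ c ⁆
  p⊆ z∈ with only z∈
  ... | inj₁ refl        = x∈p∪q⁺ (inj₁ (x∈p∪q⁺ (inj₁ (x∈⁅x⁆ a))))
  ... | inj₂ (inj₁ refl) = x∈p∪q⁺ (inj₁ (x∈p∪q⁺ (inj₂ (x∈⁅x⁆ b))))
  ... | inj₂ (inj₂ refl) = x∈p∪q⁺ (inj₂ (x∈⁅x⁆ c))

module _ (H : Graph n) where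

  Adj⇒∈ : ∀ {u z} → Adj H u z → z ∈ neighbours H u
  Adj⇒∈ {u} {z} uz = lookup⇒[]= z _ (trans (lookup∘tabulate _ z) (dec-true (adj? H u z) uz))

  ∈⇒Adj : ∀ {u z} → z ∈ neighbours H u → Adj H u z
  ∈⇒Adj {u} {z} z∈ with adj? H u z | trans (sym (lookup∘tabulate (does ∘ adj? H u) z)) ([]=⇒lookup z∈)
  ... | yes uz | _ = uz
  ... | no _   | ()

  neighbours≡ : ∀ {u p} → (∀ {z} → Adj H u z → z ∈ p) → (∀ {z} → z ∈ p → Adj H u z) → neighbours H u ≡ p
  neighbours≡ to from = ⊆-antisym (to ∘ ∈⇒Adj) (Adj⇒∈ ∘ from)

  matchingOn⁺ : ∀ {U} → (∀ {u s t} → u ∈ U → s ∈ U → t ∈ U → Adj H u s → Adj H u t → s ≡ t) → HasMatchingOn H U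
  matchingOn⁺ {U} matching {u} u∈ = ≡⇒∣p∣≤1 _ λ s∈ t∈ →
    let (us , s∈U) = x∈p∩q⁻ (neighbours H u) U s∈
        (ut , t∈U) = x∈p∩q⁻ (neighbours H u) U t∈
    in matching u∈ s∈U t∈U (∈⇒Adj us) (∈⇒Adj ut)

  matchingOn⁻ : ∀ {U} → HasMatchingOn H U → ∀ {u s t} → u ∈ U → s ∈ U → t ∈ U → Adj H u s → Adj H u t → s ≡ t
  matchingOn⁻ matching u∈ s∈ t∈ us ut =
    ∣p∣≤1⇒≡ (matching u∈) (x∈p∩q⁺ (Adj⇒∈ us , s∈)) (x∈p∩q⁺ (Adj⇒∈ ut , t∈))

-- Relabelling

⟨$⟩ʳ-injective : ∀ (π : Permutation′ n) {i j} → π ⟨$⟩ʳ i ≡ π ⟨$⟩ʳ j → i ≡ j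
⟨$⟩ʳ-injective π = Injection.injective (↔⇒↣ π)

-- After the tails are matched by `π`, the transposition of `π ⟨$⟩ʳ x` and `y` repairs the heads.
-- Neither of these lies in the tail of the target, so the tails stay matched.
relabelling : (xs ys : List (Fin n)) → Unique xs → Unique ys → List.length xs ≡ List.length ys →
              ∃[ π ] map (π ⟨$⟩ʳ_) xs ≡ ys
relabelling []       []       _         _         _  = Permutation.id , refl
relabelling (x ∷ xs) (y ∷ ys) (x∉ ∷ ux) (y∉ ∷ uy) eq
  with π , refl ← relabelling xs ys ux uy (ℕ.suc-injective eq) =
  π ∘ₚ transpose (π ⟨$⟩ʳ x) y , cong₂ _∷_ moved
    (trans (map-∘ xs) (unmoved _ (All.map⁺ (All.map (_∘ ⟨$⟩ʳ-injective π) x∉)) y∉))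
  where
  moved : transpose (π ⟨$⟩ʳ x) y ⟨$⟩ʳ (π ⟨$⟩ʳ x) ≡ y
  moved rewrite dec-true ((π ⟨$⟩ʳ x) Fin.≟ (π ⟨$⟩ʳ x)) refl = refl
  fixed : ∀ {i j k : Fin _} → i ≢ k → j ≢ k → transpose i j ⟨$⟩ʳ k ≡ k
  fixed {i} {j} {k} i≢k j≢k
    rewrite dec-false (k Fin.≟ i) (≢-sym i≢k) | dec-false (k Fin.≟ j) (≢-sym j≢k) = refl
  unmoved : ∀ {i j : Fin _} zs → All (i ≢_) zs → All (j ≢_) zs → map (transpose i j ⟨$⟩ʳ_) zs ≡ zs
  unmoved []       []        []        = refl
  unmoved (z ∷ zs) (i≢ ∷ is) (j≢ ∷ js) = cong₂ _∷_ (fixed i≢ j≢) (unmoved zs is js)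

relabel : Permutation′ n → Graph n → Graph n
relabel π G = record
  { Adj        = λ i j → Adj G (π ⟨$⟩ʳ i) (π ⟨$⟩ʳ j)
  ; adj?       = λ i j → adj? G (π ⟨$⟩ʳ i) (π ⟨$⟩ʳ j)
  ; adj-sym    = adj-sym G
  ; adj-irrefl = λ i → adj-irrefl G (π ⟨$⟩ʳ i)
  }

relabel-≅ : ∀ (π : Permutation′ n) (G : Graph n) → G ≅ relabel π G
relabel-≅ π G = record
  -- Vertex `i` of the relabelled graph stands for `π ⟨$⟩ʳ i`, so the map out of `G` is the inverse.
  { bijection = flip π
  ; adj⇔      = λ u v → mk⇔
      (subst₂ (Adj G) (sym (inverseʳ π)) (sym (inverseʳ π)))
      (subst₂ (Adj G) (inverseʳ π) (inverseʳ π))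
  }

relabel-C4Free : ∀ (π : Permutation′ n) (G : Graph n) → C4Free (Adj G) → C4Free (Adj (relabel π G))
relabel-C4Free π G c4free s≢u t≢v = c4free (s≢u ∘ ⟨$⟩ʳ-injective π) (t≢v ∘ ⟨$⟩ʳ-injective π)

-- Membership in the three families.

module Members (n : ℕ) (6≤n : 6 ≤ n) where

  open Families n 6≤n

  v≢y : v ≢ y
  v≢y eq = 0≢ 6≤n (fromℕ<-injective _ _ _ _ eq)
    where
    0≢ : ∀ {m} → 6 ≤ m → 0 ≢ m ∸ 1
    0≢ (s≤s (s≤s _)) ()

  v≢xₙ₋₂ : v ≢ xₙ₋₂
  v≢xₙ₋₂ eq = 0≢ 6≤n (fromℕ<-injective _ _ _ _ eq)
    where
    0≢ : ∀ {m} → 6 ≤ m → 0 ≢ m ∸ 2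
    0≢ (s≤s (s≤s (s≤s _))) ()

  y≢xₙ₋₂ : y ≢ xₙ₋₂
  y≢xₙ₋₂ eq = n∸1≢ 6≤n (fromℕ<-injective _ _ _ _ eq)
    where
    n∸1≢ : ∀ {m} → 6 ≤ m → m ∸ 1 ≢ m ∸ 2
    n∸1≢ (s≤s (s≤s _)) = ℕ.1+n≢n

  ∈X⁺ : ∀ {z} → v ≢ z → y ≢ z → z ∈ X
  ∈X⁺ v≢z y≢z = x∉p⇒x∈∁p λ z∈ →
    [ (λ z∈v → v≢z (sym (x∈⁅y⁆⇒x≡y v z∈v))) , (λ z∈y → y≢z (sym (x∈⁅y⁆⇒x≡y y z∈y))) ]′ (x∈p∪q⁻ ⁅ v ⁆ ⁅ y ⁆ z∈)

  ∈X⇒v≢ : ∀ {z} → z ∈ X → v ≢ z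
  ∈X⇒v≢ z∈ refl = x∈∁p⇒x∉p z∈ (x∈p∪q⁺ (inj₁ (x∈⁅x⁆ v)))

  ∈X⇒y≢ : ∀ {z} → z ∈ X → y ≢ z
  ∈X⇒y≢ z∈ refl = x∈∁p⇒x∉p z∈ (x∈p∪q⁺ (inj₂ (x∈⁅x⁆ y)))

  ∈X∪y⁺ : ∀ {z} → v ≢ z → z ∈ X ∪ ⁅ y ⁆
  ∈X∪y⁺ {z} v≢z with y Fin.≟ z
  ... | yes refl = x∈p∪q⁺ (inj₂ (x∈⁅x⁆ y))
  ... | no y≢z   = x∈p∪q⁺ (inj₁ (∈X⁺ v≢z y≢z))

  ∈X∪y⇒v≢ : ∀ {z} → z ∈ X ∪ ⁅ y ⁆ → v ≢ z
  ∈X∪y⇒v≢ z∈ with x∈p∪q⁻ X ⁅ y ⁆ z∈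
  ... | inj₁ z∈X = ∈X⇒v≢ z∈X
  ... | inj₂ z∈y = subst (v ≢_) (sym (x∈⁅y⁆⇒x≡y y z∈y)) v≢y

  nonNeighbour≡y : ∀ H → neighbours H v ≡ X → ∀ {z} → z ≢ v → ¬ Adj H v z → y ≡ z
  nonNeighbour≡y H v-nbrs {z} z≢v ¬vz = decidable-stable (y Fin.≟ z) λ y≢z →
    ¬vz (∈⇒Adj H (subst (z ∈_) (sym v-nbrs) (∈X⁺ (≢-sym z≢v) y≢z)))

  v⊎X∪y : ∀ {P : Pred (Fin n) 0ℓ} z → z ≡ v ⊎ z ∈ X ∪ ⁅ y ⁆ ⊎ P z
  v⊎X∪y z with v Fin.≟ z
  ... | yes v≡z = inj₁ (sym v≡z)
  ... | no v≢z  = inj₂ (inj₁ (∈X∪y⁺ v≢z))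

  -- In `𝒢₂` the matching covers only `X`, but there `y` is pendant at `xₙ₋₂`.
  𝒢⇒shape : ∀ {H} → Families.𝒢 n 6≤n H → NearlyFriendship H
  𝒢⇒shape {H} (inj₁ (v-nbrs , matching)) = record
    { centre       = v
    ; nonNeighbour = λ s≢ t≢ ¬s ¬t → trans (sym (nonNeighbour≡y H v-nbrs s≢ ¬s)) (nonNeighbour≡y H v-nbrs t≢ ¬t)
    ; Matched      = _∈ X ∪ ⁅ y ⁆
    ; cover        = v⊎X∪y {λ z → ∀ {s t} → Adj H z s → Adj H z t → s ≡ t}
    ; matching     = matchingOn⁻ H matching
    }
  𝒢⇒shape {H} (inj₂ (inj₁ (v-nbrs , y-nbrs , _ , matching))) = record
    { centre       = v
    ; nonNeighbour = λ s≢ t≢ ¬s ¬t → trans (sym (nonNeighbour≡y H v-nbrs s≢ ¬s)) (nonNeighbour≡y H v-nbrs t≢ ¬t)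
    ; Matched      = _∈ X
    ; cover        = cover
    ; matching     = matchingOn⁻ H matching
    }
    where
    y-nbr : ∀ {s} → Adj H y s → s ≡ xₙ₋₂
    y-nbr ys = x∈⁅y⁆⇒x≡y xₙ₋₂ (subst (_ ∈_) y-nbrs (Adj⇒∈ H ys))
    cover : ∀ z → z ≡ v ⊎ z ∈ X ⊎ (∀ {s t} → Adj H z s → Adj H z t → s ≡ t)
    cover z with v Fin.≟ z | y Fin.≟ z
    ... | yes v≡z | _ = inj₁ (sym v≡z)
    ... | no _ | yes refl = inj₂ (inj₂ λ ys yt → trans (y-nbr ys) (sym (y-nbr yt)))
    ... | no v≢z | no y≢z = inj₂ (inj₁ (∈X⁺ v≢z y≢z))
  𝒢⇒shape {H} (inj₂ (inj₂ (v-nbrs , matching))) = record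
    { centre       = v
    ; nonNeighbour = λ s≢ _ ¬s _ → contradiction (∈⇒Adj H (subst (_ ∈_) (sym v-nbrs) (∈X∪y⁺ (≢-sym s≢)))) ¬s
    ; Matched      = _∈ X ∪ ⁅ y ⁆
    ; cover        = v⊎X∪y {λ z → ∀ {s t} → Adj H z s → Adj H z t → s ≡ t}
    ; matching     = matchingOn⁻ H matching
    }

  module _ (H : Graph n) (c4free : C4Free (Adj H)) where

    -- Two common neighbours would be opposite corners of a C₄. With `v` as one of the two vertices,
    -- this yields the matching conditions inside the neighbourhood of `v`.
    commonNeighbour-unique : ∀ {u w s t} → u ≢ w → Adj H u s → Adj H w s → Adj H u t → Adj H w t → s ≡ t
    commonNeighbour-unique {s = s} {t} u≢w us ws ut wt = decidable-stable (s Fin.≟ t) λ s≢t →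
      c4free u≢w s≢t us (adj-sym H ws) wt (adj-sym H ut)

    𝒢₃⁺ : (∀ {z} → v ≢ z → Adj H v z) → 𝒢₃ H
    𝒢₃⁺ v-all = neighbours≡ H (∈X∪y⁺ ∘ Adj⇒≢ H) (v-all ∘ ∈X∪y⇒v≢) ,
      matchingOn⁺ H λ u∈ s∈ t∈ us ut →
        commonNeighbour-unique (∈X∪y⇒v≢ u∈) (v-all (∈X∪y⇒v≢ s∈)) us (v-all (∈X∪y⇒v≢ t∈)) ut

    module _ (v-X : ∀ {z} → v ≢ z → y ≢ z → Adj H v z) (¬vy : ¬ Adj H v y) where

      v-nbrs : neighbours H v ≡ X
      v-nbrs = neighbours≡ H (λ vz → ∈X⁺ (Adj⇒≢ H vz) λ { refl → ¬vy vz }) λ z∈ → v-X (∈X⇒v≢ z∈) (∈X⇒y≢ z∈)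

      X-matching : ∀ {u s t} → v ≢ u → s ∈ X → t ∈ X → Adj H u s → Adj H u t → s ≡ t
      X-matching v≢u s∈ t∈ us ut =
        commonNeighbour-unique v≢u (v-X (∈X⇒v≢ s∈) (∈X⇒y≢ s∈)) us (v-X (∈X⇒v≢ t∈) (∈X⇒y≢ t∈)) ut

      -- `X-matching` settles two neighbours in `X`; when one of them is `y`, the hypothesis forces
      -- the other to be `y` as well.
      𝒢₁⁺ : (∀ {x x′} → Adj H y x → Adj H x x′ → v ≢ x′ → y ≡ x′) → 𝒢₁ H
      𝒢₁⁺ isolated = v-nbrs , matchingOn⁺ H matching
        where
        matching : ∀ {u s t} → u ∈ X ∪ ⁅ y ⁆ → s ∈ X ∪ ⁅ y ⁆ → t ∈ X ∪ ⁅ y ⁆ → Adj H u s → Adj H u t → s ≡ t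
        matching {u} {s} {t} u∈ s∈ t∈ us ut with x∈p∪q⁻ X ⁅ y ⁆ s∈ | x∈p∪q⁻ X ⁅ y ⁆ t∈
        ... | inj₁ s∈X | inj₁ t∈X = X-matching (∈X∪y⇒v≢ u∈) s∈X t∈X us ut
        ... | inj₂ s∈y | _ with refl ← x∈⁅y⁆⇒x≡y y s∈y = isolated (adj-sym H us) ut (∈X∪y⇒v≢ t∈)
        ... | inj₁ _ | inj₂ t∈y with refl ← x∈⁅y⁆⇒x≡y y t∈y = sym (isolated (adj-sym H ut) us (∈X∪y⇒v≢ s∈))

      -- `X-matching` at `y` leaves `xₙ₋₂` as its only neighbour, and at `xₙ₋₂` leaves `x′` as its
      -- only neighbour in `X`; with `v` and `y` this makes degree 3.
      𝒢₂⁺ : ∀ {x′} → Adj H y xₙ₋₂ → Adj H xₙ₋₂ x′ → v ≢ x′ → y ≢ x′ → 𝒢₂ H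
      𝒢₂⁺ {x′} yx xx′ v≢x′ y≢x′ = v-nbrs ,
        neighbours≡ H (λ yz → subst (_∈ ⁅ xₙ₋₂ ⁆) (X-matching v≢y x∈X (y-nbr∈X yz) yx yz) (x∈⁅x⁆ xₙ₋₂))
                      (λ z∈ → subst (Adj H y) (sym (x∈⁅y⁆⇒x≡y xₙ₋₂ z∈)) yx) ,
        ∣p∣≡3 v≢y v≢x′ y≢x′
          (Adj⇒∈ H (adj-sym H (v-X (∈X⇒v≢ x∈X) (∈X⇒y≢ x∈X)))) (Adj⇒∈ H (adj-sym H yx)) (Adj⇒∈ H xx′) only ,
        matchingOn⁺ H (X-matching ∘ ∈X⇒v≢)
        where
        y-nbr∈X : ∀ {z} → Adj H y z → z ∈ X
        y-nbr∈X yz = ∈X⁺ (λ { refl → ¬vy (adj-sym H yz) }) (Adj⇒≢ H yz)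
        x∈X : xₙ₋₂ ∈ X
        x∈X = y-nbr∈X yx
        only : ∀ {z} → z ∈ neighbours H xₙ₋₂ → z ≡ v ⊎ z ≡ y ⊎ z ≡ x′
        only {z} z∈ with v Fin.≟ z | y Fin.≟ z
        ... | yes v≡z | _ = inj₁ (sym v≡z)
        ... | no _ | yes y≡z = inj₂ (inj₁ (sym y≡z))
        ... | no v≢z | no y≢z = inj₂ (inj₂ (X-matching (∈X⇒v≢ x∈X) (∈X⁺ v≢z y≢z) (∈X⁺ v≢x′ y≢x′) (∈⇒Adj H z∈) xx′))

  module _ (G : Graph n) (c4free : C4Free (Adj G)) where

    classify₃ : ∀ v₀ → (∀ {z} → v₀ ≢ z → Adj G v₀ z) → G ∈-upToIso Families.𝒢 n 6≤n
    classify₃ v₀ v₀-all with π , refl ← relabelling (v ∷ []) (v₀ ∷ []) ([] ∷ []) ([] ∷ []) refl =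
      H , inj₂ (inj₂ (𝒢₃⁺ H (relabel-C4Free π G c4free) λ v≢z → v₀-all (v≢z ∘ ⟨$⟩ʳ-injective π))) , relabel-≅ π G
      where H = relabel π G

    classify₁ : ∀ {v₀ y₀} → v₀ ≢ y₀ → (∀ {z} → v₀ ≢ z → y₀ ≢ z → Adj G v₀ z) → ¬ Adj G v₀ y₀ →
      (∀ {x x′} → Adj G y₀ x → Adj G x x′ → v₀ ≢ x′ → y₀ ≡ x′) → G ∈-upToIso Families.𝒢 n 6≤n
    classify₁ {v₀} {y₀} v₀≢y₀ v₀-adj ¬v₀y₀ isolated
      with π , refl ← relabelling (v ∷ y ∷ []) (v₀ ∷ y₀ ∷ []) ((v≢y ∷ []) ∷ [] ∷ []) ((v₀≢y₀ ∷ []) ∷ [] ∷ []) refl =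
      H , inj₁ (𝒢₁⁺ H (relabel-C4Free π G c4free)
        (λ v≢z y≢z → v₀-adj (v≢z ∘ π-inj) (y≢z ∘ π-inj)) ¬v₀y₀
        (λ yx xx′ v≢x′ → π-inj (isolated yx xx′ (v≢x′ ∘ π-inj)))) , relabel-≅ π G
      where
      H = relabel π G
      π-inj : ∀ {i j} → π ⟨$⟩ʳ i ≡ π ⟨$⟩ʳ j → i ≡ j
      π-inj = ⟨$⟩ʳ-injective π

    classify₂ : ∀ {v₀ y₀ x₀ x₁} → v₀ ≢ y₀ → (∀ {z} → v₀ ≢ z → y₀ ≢ z → Adj G v₀ z) → ¬ Adj G v₀ y₀ →
      Adj G y₀ x₀ → Adj G x₀ x₁ → v₀ ≢ x₁ → y₀ ≢ x₁ → G ∈-upToIso Families.𝒢 n 6≤n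
    classify₂ {v₀} {y₀} {x₀} {x₁} v₀≢y₀ v₀-adj ¬v₀y₀ y₀x₀ x₀x₁ v₀≢x₁ y₀≢x₁
      with π , refl ← relabelling (v ∷ y ∷ xₙ₋₂ ∷ []) (v₀ ∷ y₀ ∷ x₀ ∷ [])
                        ((v≢y ∷ v≢xₙ₋₂ ∷ []) ∷ (y≢xₙ₋₂ ∷ []) ∷ [] ∷ [])
                        ((v₀≢y₀ ∷ (λ { refl → ¬v₀y₀ (adj-sym G y₀x₀) }) ∷ []) ∷ (Adj⇒≢ G y₀x₀ ∷ []) ∷ [] ∷ []) refl =
      H , inj₂ (inj₁ (𝒢₂⁺ H (relabel-C4Free π G c4free)
        (λ v≢z y≢z → v₀-adj (v≢z ∘ π-inj) (y≢z ∘ π-inj)) ¬v₀y₀ y₀x₀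
        -- No label is prescribed for `x₁`, so it is reached through the inverse of `π`.
        (subst (Adj G _) (sym (inverseʳ π)) x₀x₁)
        (λ eq → v₀≢x₁ (trans (cong (π ⟨$⟩ʳ_) eq) (inverseʳ π)))
        (λ eq → y₀≢x₁ (trans (cong (π ⟨$⟩ʳ_) eq) (inverseʳ π))))) , relabel-≅ π G
      where
      H = relabel π G
      π-inj : ∀ {i j} → π ⟨$⟩ʳ i ≡ π ⟨$⟩ʳ j → i ≡ j
      π-inj = ⟨$⟩ʳ-injective π

    -- If `v₀` misses no vertex, the graph is in `𝒢₃`. Otherwise it is in `𝒢₂` or `𝒢₁` according to
    -- whether some neighbour of `y₀` has a neighbour besides `v₀` and `y₀`.
    classify : ∀ v₀ y₀ → (∀ {z} → v₀ ≢ z → y₀ ≢ z → Adj G v₀ z) → G ∈-upToIso Families.𝒢 n 6≤n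
    classify v₀ y₀ v₀-adj with v₀ Fin.≟ y₀ | adj? G v₀ y₀
    ... | yes refl | _ = classify₃ v₀ λ v₀≢z → v₀-adj v₀≢z v₀≢z
    ... | no _ | yes v₀y₀ = classify₃ v₀ v₀-all
      where
      v₀-all : ∀ {z} → v₀ ≢ z → Adj G v₀ z
      v₀-all {z} v₀≢z with y₀ Fin.≟ z
      ... | yes refl = v₀y₀
      ... | no y₀≢z  = v₀-adj v₀≢z y₀≢z
    ... | no v₀≢y₀ | no ¬v₀y₀ with Fin.any? (λ x₀ → Fin.any? (λ x₁ →
            adj? G y₀ x₀ ×-dec adj? G x₀ x₁ ×-dec ¬? (v₀ Fin.≟ x₁) ×-dec ¬? (y₀ Fin.≟ x₁)))
    ...   | yes (_ , _ , y₀x₀ , x₀x₁ , v₀≢x₁ , y₀≢x₁) = classify₂ v₀≢y₀ v₀-adj ¬v₀y₀ y₀x₀ x₀x₁ v₀≢x₁ y₀≢x₁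
    ...   | no none = classify₁ v₀≢y₀ v₀-adj ¬v₀y₀ λ {x₀} {x₁} y₀x₀ x₀x₁ v₀≢x₁ →
            decidable-stable (y₀ Fin.≟ x₁) λ y₀≢x₁ → none (x₀ , x₁ , y₀x₀ , x₀x₁ , v₀≢x₁ , y₀≢x₁)

-- The Ramsey number and the critical graphs.

module Characterisation (Γ₁ Γ₂ : CycleSet) (n : ℕ) (6≤n : 6 ≤ n)
  (n-shortest : IsShortestLength Γ₁ n) (4-shortest : IsShortestLength Γ₂ 4) where

  shape⇒avoiding : N ≤ n → (G : RedBlueGraph N) → NearlyFriendship (blueSubgraph G) → Avoiding Γ₁ Γ₂ G
  shape⇒avoiding N≤n G shape =
    (λ (C , C∈ , C⊑) → noRedCycle shape C (ℕ.≤-trans N≤n (proj₂ n-shortest C C∈)) C⊑) ,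
    (λ (C , C∈ , C⊑) → noBlueCycle shape C (proj₂ 4-shortest C C∈) C⊑)

  fromBlueC4 : (G : RedBlueGraph N) → C4 (blueSubgraph G) → ContainsFrom Γ₂ (blueSubgraph G)
  fromBlueC4 G c4 = let (C , C∈ , len) , _ = 4-shortest in
    C , C∈ , C4⇒⊑ (blueSubgraph G) C len c4

  fromRedCycle : (G : RedBlueGraph N) → ∀ {L} → Unique L → List.length L ≡ n →
    HasCycleOn (Adj (redSubgraph G)) L → ContainsFrom Γ₁ (redSubgraph G)
  fromRedCycle G u len cyc = let (C , C∈ , len′) , _ = n-shortest in
    C , C∈ , HasCycleOn⇒⊑ (redSubgraph G) C u (trans len (sym len′)) cyc

  private
    excess : ∃[ k ] n ≡ 6 + k
    excess = let k , 6+k≡n = ℕ.m≤n⇒∃[o]m+o≡n 6≤n in k , sym 6+k≡n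

  -- Without a blue C₄, the red cycle that misses exactly one of the `suc n` vertices has the length
  -- `n` that occurs in `Γ₁`.
  arrows : Arrows Γ₁ Γ₂ (suc n)
  arrows G with C4? (blueSubgraph G) | excess
  ... | yes c4 | _ = inj₂ (fromBlueC4 G c4)
  ... | no ¬c4 | k , n≡6+k
      with w , L , σ , cyc ← cycleMissingOne (twoColouring G) (¬C4⇒C4Free (blueSubgraph G) ¬c4) Fin._≟_ k
                               (Unique.allFin⁺ (suc n)) (trans (length-tabulate id) (cong suc n≡6+k))
      with _ ∷ u ← Unique-resp-↭ σ (Unique.allFin⁺ (suc n)) =
    inj₁ (fromRedCycle G u (ℕ.suc-injective (trans (sym (↭-length σ)) (length-tabulate id))) cyc)

  n<ramsey : ∀ M → 0 < M → Arrows Γ₁ Γ₂ M → suc n ≤ M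
  n<ramsey (suc M) _ arrows-M with suc n ℕ.≤? suc M
  ... | yes n<M = n<M
  ... | no n≮M
      with ¬red , ¬blue ← shape⇒avoiding (ℕ.≤-pred (ℕ.≰⇒> n≮M)) star star-shape | arrows-M star
  ...   | inj₁ r = contradiction r ¬red
  ...   | inj₂ b = contradiction b ¬blue

  isRamseyNumber : IsRamseyNumber Γ₁ Γ₂ (suc n)
  isRamseyNumber = z<s , arrows , n<ramsey

  avoiding⇒∈𝒢 : (G : RedBlueGraph n) → Avoiding Γ₁ Γ₂ G → blueSubgraph G ∈-upToIso 𝒢 n 6≤n
  avoiding⇒∈𝒢 G (¬red , ¬blue) with k , n≡6+k ← excess
      with cycleOn⊎nearlyAllBlue (twoColouring G) (¬C4⇒C4Free (blueSubgraph G) (¬blue ∘ fromBlueC4 G)) Fin._≟_ k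
             (Unique.allFin⁺ n) (trans (length-tabulate id) n≡6+k)
  ... | inj₁ cyc = contradiction (fromRedCycle G (Unique.allFin⁺ n) (length-tabulate id) cyc) ¬red
  ... | inj₂ (v₀ , _ , y₀ , v₀-blue) =
    Members.classify n 6≤n (blueSubgraph G) (¬C4⇒C4Free (blueSubgraph G) (¬blue ∘ fromBlueC4 G)) v₀ y₀
      (v₀-blue (∈-allFin _))

  critical⇒∈𝒢 : (G : RedBlueGraph N) → Critical Γ₁ Γ₂ G → blueSubgraph G ∈-upToIso 𝒢 n 6≤n
  critical⇒∈𝒢 G (avoiding , R , (0<R , arrows-R , R-least) , refl)
    -- The two bounds give `R` the value `suc n`, so that `G` has `n` vertices.
    with refl ← ℕ.≤-antisym (R-least (suc n) z<s arrows) (n<ramsey R 0<R arrows-R) = avoiding⇒∈𝒢 G avoiding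

  ∈𝒢⇒critical : (G : RedBlueGraph N) → blueSubgraph G ∈-upToIso 𝒢 n 6≤n → Critical Γ₁ Γ₂ G
  ∈𝒢⇒critical G (H , H∈𝒢 , G≅H) with refl ← ↔⇒≡ (_≅_.bijection G≅H) =
    shape⇒avoiding ℕ.≤-refl G (NearlyFriendship-resp-≅ G≅H (Members.𝒢⇒shape n 6≤n H∈𝒢)) ,
    suc n , isRamseyNumber , refl

theorem1p12 : (Γ₁ Γ₂ : CycleSet) → Satisfiable Γ₁ → Satisfiable Γ₂ →
    (n : ℕ) (6≤n : 6 ≤ n) → IsShortestLength Γ₁ n → IsShortestLength Γ₂ 4 →
    {N : ℕ} (G : RedBlueGraph N) →
    Critical Γ₁ Γ₂ G ⇔ (blueSubgraph G ∈-upToIso 𝒢 n 6≤n)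
theorem1p12 Γ₁ Γ₂ _ _ n 6≤n n-shortest 4-shortest G = mk⇔ (critical⇒∈𝒢 G) (∈𝒢⇒critical G)
  where open Characterisation Γ₁ Γ₂ n 6≤n n-shortest 4-shortest
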